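{- Every nilpotently vertex-transitive graph of valency at least four admits a nowhere-zero $3$-flow.
   Context: All graphs are finite and undirected; parallel edges are allowed, and vertex-transitive graphs are assumed to have no loops. An automorphism of a graph $G$ is a bijection of $V(G)\cup E(G)$ mapping $V(G)$ onto $V(G)$ and $E(G)$ onto $E(G)$ that preserves incidence; these form the group $\mathrm{Aut}(G)$. A graph is nilpotently vertex-transitive if $\mathrm{Aut}(G)$ contains a nilpotent subgroup acting transitively on $V(G)$. For an orientation $D$ of $G$ and integer-valued $\varphi$ on $E(G)$, write $\varphi^{+}(v)$ (resp. $\varphi^-(v)$) for the sum of $\varphi(e)$ over edges $e$ with tail (resp. head) $v$. A nowhere-zero $k$-flow is a pair $(D,\varphi)$ with $0<|\varphi(e)|<k$ for all edges $e$ and $\varphi^+(v)=\varphi^-(v)$ for all vertices $v$; $G$ admits a nowhere-zero $k$-flow if such a pair exists for some orientation. -}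

module Defs where

open import Data.Nat using (ℕ; zero; suc; _+_; _≤_; _<_)
open import Data.Integer as ℤ using (ℤ; ∣_∣)
open import Data.Fin using (Fin; zero; suc; _≟_)
open import Data.Fin.Permutation using (Permutation′; _⟨$⟩ʳ_; id; flip; _∘ₚ_)
open import Data.Product using (Σ; _×_; _,_; proj₁; proj₂; ∃; ∃-syntax)
open import Data.Sum using (_⊎_)
open import Data.Bool using (Bool; true; false; if_then_else_)
open import Relation.Nullary using (¬_)
open import Relation.Nullary.Decidable using (⌊_⌋)
open import Relation.Binary.PropositionalEquality using (_≡_)
open import Function.Bundles using (_⇔_)

-- A finite multigraph: vertices Fin n, edges Fin m, each edge has two ends.
-- Parallel edges are allowed (ends need not be injective).
record Graph : Set where
  field
    n    : ℕ
    m    : ℕ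
    ends : Fin m → Fin n × Fin n
open Graph public

Vtx : Graph → Set
Vtx G = Fin (n G)

Edg : Graph → Set
Edg G = Fin (m G)

Loopless : Graph → Set
Loopless G = (e : Edg G) → ¬ (proj₁ (ends G e) ≡ proj₂ (ends G e))

Inc : (G : Graph) → Vtx G → Edg G → Set
Inc G v e = (v ≡ proj₁ (ends G e)) ⊎ (v ≡ proj₂ (ends G e))

sumℕ : (k : ℕ) → (Fin k → ℕ) → ℕ
sumℕ zero    f = 0
sumℕ (suc k) f = f zero + sumℕ k (λ i → f (suc i))

sumℤ : (k : ℕ) → (Fin k → ℤ) → ℤ
sumℤ zero    f = ℤ.0ℤ
sumℤ (suc k) f = f zero ℤ.+ sumℤ k (λ i → f (suc i))

ind : {k : ℕ} → Fin k → Fin k → ℕ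
ind u v = if ⌊ u ≟ v ⌋ then 1 else 0

-- degree of a vertex (number of edge-ends at v; a loop would count twice)
degree : (G : Graph) → Vtx G → ℕ
degree G v = sumℕ (m G) (λ e → ind (proj₁ (ends G e)) v + ind (proj₂ (ends G e)) v)

Perm : Graph → Set
Perm G = Permutation′ (n G) × Permutation′ (m G)

IsAut : (G : Graph) → Perm G → Set
IsAut G (σ , τ) = (v : Vtx G) (e : Edg G) → Inc G v e ⇔ Inc G (σ ⟨$⟩ʳ v) (τ ⟨$⟩ʳ e)

module AutOps (G : Graph) where

  _≈ₐ_ : Perm G → Perm G → Set
  (σ , τ) ≈ₐ (σ′ , τ′) = (∀ v → σ ⟨$⟩ʳ v ≡ σ′ ⟨$⟩ʳ v) × (∀ e → τ ⟨$⟩ʳ e ≡ τ′ ⟨$⟩ʳ e)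

  idₐ : Perm G
  idₐ = id , id

  _·_ : Perm G → Perm G → Perm G
  (σ , τ) · (σ′ , τ′) = (σ ∘ₚ σ′) , (τ ∘ₚ τ′)

  _⁻¹ : Perm G → Perm G
  (σ , τ) ⁻¹ = flip σ , flip τ

  [_,_] : Perm G → Perm G → Perm G
  [ x , y ] = (((x ⁻¹) · (y ⁻¹)) · x) · y

  record IsSubgroupOfAut (H : Perm G → Set) : Set where
    field
      ⊆aut  : ∀ x → H x → IsAut G x
      resp  : ∀ x y → x ≈ₐ y → H x → H y
      has-id : H idₐ
      ·-closed : ∀ x y → H x → H y → H (x · y)
      ⁻¹-closed : ∀ x → H x → H (x ⁻¹)

  Z : (Perm G → Set) → ℕ → Perm G → Set
  Z H zero    x = x ≈ₐ idₐ
  Z H (suc i) x = H x × (∀ y → H y → Z H i [ x , y ])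

  IsNilpotent : (Perm G → Set) → Set
  IsNilpotent H = ∃[ c ] (∀ x → H x → Z H c x)

  ActsTransitively : (Perm G → Set) → Set
  ActsTransitively H = (u v : Vtx G) → ∃[ x ] (H x × (proj₁ x ⟨$⟩ʳ u ≡ v))

NilpotentlyVertexTransitive : Graph → Set₁
NilpotentlyVertexTransitive G =
  ∃[ H ] (IsSubgroupOfAut H × IsNilpotent H × ActsTransitively H)
  where open AutOps G

Orientation : Graph → Set
Orientation G = Edg G → Bool

tail head : (G : Graph) → Orientation G → Edg G → Vtx G
tail G D e = if D e then proj₁ (ends G e) else proj₂ (ends G e)
head G D e = if D e then proj₂ (ends G e) else proj₁ (ends G e)

φ⁺ φ⁻ : (G : Graph) → Orientation G → (Edg G → ℤ) → Vtx G → ℤ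
φ⁺ G D φ v = sumℤ (m G) (λ e → if ⌊ tail G D e ≟ v ⌋ then φ e else ℤ.0ℤ)
φ⁻ G D φ v = sumℤ (m G) (λ e → if ⌊ head G D e ≟ v ⌋ then φ e else ℤ.0ℤ)

IsNowhereZeroFlow : (G : Graph) → ℕ → Orientation G → (Edg G → ℤ) → Set
IsNowhereZeroFlow G k D φ =
  ((e : Edg G) → (0 < ∣ φ e ∣) × (∣ φ e ∣ < k)) ×
  ((v : Vtx G) → φ⁺ G D φ v ≡ φ⁻ G D φ v)

AdmitsNZFlow : Graph → ℕ → Set
AdmitsNZFlow G k = ∃[ D ] ∃[ φ ] IsNowhereZeroFlow G k D φ

{-# OPTIONS --safe #-}
module Submission where

-- A flow with values modulo 3 is recorded by its net values on ordered pairs of vertices,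
-- and Tutte's augmentation argument turns it into an integer flow.  If no element of the
-- nilpotent group H swaps two vertices, choosing one orbital from each pair of mutually
-- inverse ones gives an H-invariant orientation, which is balanced because its excess is
-- constant and sums to zero.  Otherwise H has an element acting as an involution, and
-- commutators lead from it to one, ζ, whose action is moreover central; ζ has no fixed
-- point.  If no edge joins a vertex v to ζ v, the graph modulo ζ is again nilpotently
-- vertex-transitive of the same valency, and its flow lifts.  If s ≥ 1 edges join v to ζ v,
-- take on the remaining edges a flow reversed by ζ, so that the excesses at v and ζ v are
-- opposite and only have to be cancelled by those s edges.  This is always possible for
-- s ≥ 2; for s = 1 all excesses must be nonzero modulo 3.  Modulo ζ this asks for an
-- orientation with nonzero excesses of a signed graph of minimum degree at least 3.  Vertices
-- are repaired one by one, each through an edge to a vertex that is repaired later; where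
-- this runs out, a path that cannot be prolonged provides a first vertex whose last edge
-- may be chosen freely.
--
-- Classical reasoning is harmless: a flow is sought among finitely many candidates, so that
-- the conclusion is ¬¬-stable.

open import Defs
open import Algebra.Bundles using (CommutativeMonoid)
open import Algebra.Properties.CommutativeMonoid.Sum as CMSum using ()
open import Algebra.Structures using (IsCommutativeMonoid)
open import Data.Bool using (Bool; true; false; not; if_then_else_)
open import Data.Empty using (⊥; ⊥-elim)
open import Data.Fin as Fin using (Fin; zero; suc; _≟_; punchIn; toℕ; combine; remQuot; funToFin; finToFun)
open import Data.Fin.Patterns using (0F; 1F; 2F; 3F)
open import Data.Fin.Permutation as Perm using (Permutation′; permutation; _⟨$⟩ʳ_)
import Data.Fin.Properties as Finₚ
open import Data.Integer as ℤ using (ℤ; +_; -[1+_]; ∣_∣)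
import Data.Integer.Properties as ℤₚ
open import Data.Integer.Tactic.RingSolver using (solve-∀)
open import Data.List using (List; []; _∷_; length; _++_; lookup)
open import Data.List.Membership.Propositional using (_∈_; _∉_)
open import Data.List.Membership.Propositional.Properties using (∈-lookup; ∈-++⁻; ∈-++⁺ˡ; ∈-++⁺ʳ)
import Data.List.Properties as Listₚ
open import Data.List.Relation.Unary.All as All using ([]; _∷_)
open import Data.List.Relation.Unary.All.Properties using (¬Any⇒All¬)
open import Data.List.Relation.Unary.AllPairs using ([]; _∷_)
open import Data.List.Relation.Unary.Any using (here; there)
open import Data.List.Relation.Unary.Linked using (Linked; [-]; _∷_)
open import Data.List.Relation.Unary.Unique.Propositional using (Unique)
open import Data.List.Relation.Unary.Unique.Propositional.Properties using (++⁺; Unique[x∷xs]⇒x∉xs)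
open import Data.Nat as ℕ using (ℕ; zero; suc; s≤s; z≤n; _+_; _^_; _≤_; _<_)
open import Data.Nat.Induction using (<-wellFounded)
import Data.Nat.Properties as ℕₚ
open import Data.Product using (Σ-syntax; _×_; _,_; proj₁; proj₂; ∃; ∃-syntax)
open import Data.Sum using (_⊎_; inj₁; inj₂)
open import Data.Unit using (⊤; tt)
open import Effect.Monad using (RawMonad)
open import Function using (_∘_; case_of_)
open import Function.Bundles using (module Equivalence)
open import Induction.WellFounded using (Acc; acc)
open import Level using (0ℓ)
open import Relation.Binary.Definitions using (tri<; tri≈; tri>)
open import Relation.Binary.PropositionalEquality hiding ([_])
open import Relation.Nullary using (¬_; Dec; yes; no; contradiction)
open import Relation.Nullary.Decidable using (⌊_⌋; ¬?; _×-dec_; _⊎-dec_; decidable-stable; ¬¬-excluded-middle)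
open import Relation.Nullary.Negation using (¬¬-Monad)

-- Finite sums

module FinSum {A : Set} {_∙_ : A → A → A} {0# : A}
              (isCM : IsCommutativeMonoid _≡_ _∙_ 0#) where

  bundle : CommutativeMonoid _ _
  bundle = record { isCommutativeMonoid = isCM }

  open IsCommutativeMonoid isCM using (assoc; comm; identityˡ; identityʳ)
  open CMSum bundle public
  open ≡-Reasoning

  infix 25 _when_
  _when_ : A → Bool → A
  a when b = if b then a else 0#

  sum-zero : ∀ {n} (f : Fin n → A) → (∀ i → f i ≡ 0#) → sum f ≡ 0#
  sum-zero {n} f f≡0 = trans (sum-cong-≗ f≡0) (sum-replicate-zero n)

  -- The two altered terms stand on opposite sides, so that no subtraction occurs and one statement
  -- serves `ℕ`, `ℤ` and `ℤ₃`.
  sum-update : ∀ {n} (f g : Fin n → A) a → (∀ v → v ≢ a → g v ≡ f v) →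
               f a ∙ sum g ≡ g a ∙ sum f
  sum-update {suc n} f g a g≡f = begin
    f a ∙ sum g         ≡⟨ cong (f a ∙_) (sum-remove {i = a} g) ⟩
    f a ∙ (g a ∙ rest g) ≡⟨ sym (assoc _ _ _) ⟩
    (f a ∙ g a) ∙ rest g ≡⟨ cong₂ _∙_ (comm _ _) (sum-cong-≗ λ i → g≡f _ (Finₚ.punchInᵢ≢i a i)) ⟩
    (g a ∙ f a) ∙ rest f ≡⟨ assoc _ _ _ ⟩
    g a ∙ (f a ∙ rest f) ≡⟨ cong (g a ∙_) (sym (sum-remove {i = a} f)) ⟩
    g a ∙ sum f ∎
    where
    rest : (Fin (suc n) → A) → A
    rest h = sum (λ i → h (punchIn a i))

  sum-single : ∀ {n} (f : Fin n → A) a → (∀ v → v ≢ a → f v ≡ 0#) → sum f ≡ f a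
  sum-single {n} f a f≡0 = begin
    sum f                 ≡⟨ sym (identityˡ _) ⟩
    0# ∙ sum f            ≡⟨ sum-update (λ _ → 0#) f a f≡0 ⟩
    f a ∙ sum {n} (λ _ → 0#) ≡⟨ cong (f a ∙_) (sum-replicate-zero n) ⟩
    f a ∙ 0#              ≡⟨ identityʳ _ ⟩
    f a ∎

  when-yes : ∀ {P : Set} (d : Dec P) {a} → P → a when ⌊ d ⌋ ≡ a
  when-yes (yes _) _ = refl
  when-yes (no ¬p) p = contradiction p ¬p

  when-no : ∀ {P : Set} (d : Dec P) {a} → ¬ P → a when ⌊ d ⌋ ≡ 0#
  when-no (yes p) ¬p = contradiction p ¬p
  when-no (no _)  _ = refl

  sum-when : ∀ {n} (f : Fin n → A) a → sum (λ v → f v when ⌊ v ≟ a ⌋) ≡ f a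
  sum-when f a = trans
    (sum-single (λ v → f v when ⌊ v ≟ a ⌋) a (λ v v≢a → when-no (v ≟ a) v≢a))
    (when-yes (a ≟ a) refl)

  sum-when′ : ∀ {n} (f : Fin n → A) a → sum (λ v → f v when ⌊ a ≟ v ⌋) ≡ f a
  sum-when′ f a = trans
    (sum-single (λ v → f v when ⌊ a ≟ v ⌋) a (λ v v≢a → when-no (a ≟ v) (v≢a ∘ sym)))
    (when-yes (a ≟ a) refl)

  -- Each term `f v` is written as a row whose only nonzero entry is at `q v`; exchanging the
  -- summations collects the two points of every fibre. The fibres will be the orbits of an
  -- involution.
  sum-two-point-fibres : ∀ {n k} (q : Fin n → Fin k) (r r′ : Fin k → Fin n) →
    (∀ j → r j ≢ r′ j) → (∀ j → q (r j) ≡ j) → (∀ j → q (r′ j) ≡ j) →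
    (∀ v → v ≡ r (q v) ⊎ v ≡ r′ (q v)) →
    ∀ f → sum f ≡ sum (λ j → f (r j) ∙ f (r′ j))
  sum-two-point-fibres {n} {k} q r r′ r≢r′ qr qr′ fibre f = begin
    sum f
      ≡⟨ sum-cong-≗ (λ v → sym (sum-when′ (λ _ → f v) (q v))) ⟩
    sum (λ v → sum (λ j → f v when ⌊ q v ≟ j ⌋))
      ≡⟨ ∑-comm (λ v j → f v when ⌊ q v ≟ j ⌋) ⟩
    sum (λ j → sum (λ v → f v when ⌊ q v ≟ j ⌋))
      ≡⟨ sum-cong-≗ (λ j → sum-cong-≗ (split j)) ⟩
    sum (λ j → sum (λ v → f v when ⌊ v ≟ r j ⌋ ∙ f v when ⌊ v ≟ r′ j ⌋))
      ≡⟨ sum-cong-≗ (λ j → trans (∑-distrib-+ (λ v → f v when ⌊ v ≟ r j ⌋) (λ v → f v when ⌊ v ≟ r′ j ⌋))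
                                 (cong₂ _∙_ (sum-when f (r j)) (sum-when f (r′ j)))) ⟩
    sum (λ j → f (r j) ∙ f (r′ j)) ∎
    where
    split : ∀ j v → f v when ⌊ q v ≟ j ⌋ ≡ f v when ⌊ v ≟ r j ⌋ ∙ f v when ⌊ v ≟ r′ j ⌋
    split j v with v ≟ r j | v ≟ r′ j
    ... | yes v≡r | yes v≡r′ = contradiction (trans (sym v≡r) v≡r′) (r≢r′ j)
    ... | yes v≡r | no _ = trans (when-yes (q v ≟ j) (trans (cong q v≡r) (qr j))) (sym (identityʳ _))
    ... | no _ | yes v≡r′ = trans (when-yes (q v ≟ j) (trans (cong q v≡r′) (qr′ j))) (sym (identityˡ _))
    ... | no v≢r | no v≢r′ = trans (when-no (q v ≟ j) q≢j) (sym (identityˡ _))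
      where
      q≢j : q v ≢ j
      q≢j refl with fibre v
      ... | inj₁ e = v≢r e
      ... | inj₂ e = v≢r′ e

module Σℕ = FinSum ℕₚ.+-0-isCommutativeMonoid
module Σℤ = FinSum ℤₚ.+-0-isCommutativeMonoid

-- The integers modulo 3

data ℤ₃ : Set where
  𝟎 𝟏 𝟐 : ℤ₃

infixl 6 _⊕_
_⊕_ : ℤ₃ → ℤ₃ → ℤ₃
𝟎 ⊕ b = b
𝟏 ⊕ 𝟎 = 𝟏
𝟏 ⊕ 𝟏 = 𝟐
𝟏 ⊕ 𝟐 = 𝟎
𝟐 ⊕ 𝟎 = 𝟐
𝟐 ⊕ 𝟏 = 𝟎
𝟐 ⊕ 𝟐 = 𝟏

⊖_ : ℤ₃ → ℤ₃
⊖ 𝟎 = 𝟎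
⊖ 𝟏 = 𝟐
⊖ 𝟐 = 𝟏

⊕-comm : ∀ a b → a ⊕ b ≡ b ⊕ a
⊕-comm 𝟎 𝟎 = refl
⊕-comm 𝟎 𝟏 = refl
⊕-comm 𝟎 𝟐 = refl
⊕-comm 𝟏 𝟎 = refl
⊕-comm 𝟏 𝟏 = refl
⊕-comm 𝟏 𝟐 = refl
⊕-comm 𝟐 𝟎 = refl
⊕-comm 𝟐 𝟏 = refl
⊕-comm 𝟐 𝟐 = refl

⊕-identityʳ : ∀ a → a ⊕ 𝟎 ≡ a
⊕-identityʳ a = ⊕-comm a 𝟎

⊕-assoc : ∀ a b c → (a ⊕ b) ⊕ c ≡ a ⊕ (b ⊕ c)
⊕-assoc 𝟎 b c = refl
⊕-assoc 𝟏 𝟎 c = refl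
⊕-assoc 𝟏 𝟏 𝟎 = refl
⊕-assoc 𝟏 𝟏 𝟏 = refl
⊕-assoc 𝟏 𝟏 𝟐 = refl
⊕-assoc 𝟏 𝟐 𝟎 = refl
⊕-assoc 𝟏 𝟐 𝟏 = refl
⊕-assoc 𝟏 𝟐 𝟐 = refl
⊕-assoc 𝟐 𝟎 c = refl
⊕-assoc 𝟐 𝟏 𝟎 = refl
⊕-assoc 𝟐 𝟏 𝟏 = refl
⊕-assoc 𝟐 𝟏 𝟐 = refl
⊕-assoc 𝟐 𝟐 𝟎 = refl
⊕-assoc 𝟐 𝟐 𝟏 = refl
⊕-assoc 𝟐 𝟐 𝟐 = refl

⊕-inverseˡ : ∀ a → ⊖ a ⊕ a ≡ 𝟎
⊕-inverseˡ 𝟎 = refl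
⊕-inverseˡ 𝟏 = refl
⊕-inverseˡ 𝟐 = refl

⊕-inverseʳ : ∀ a → a ⊕ ⊖ a ≡ 𝟎
⊕-inverseʳ a = trans (⊕-comm a (⊖ a)) (⊕-inverseˡ a)

⊖-involutive : ∀ a → ⊖ (⊖ a) ≡ a
⊖-involutive 𝟎 = refl
⊖-involutive 𝟏 = refl
⊖-involutive 𝟐 = refl

⊖-distrib-⊕ : ∀ a b → ⊖ (a ⊕ b) ≡ ⊖ a ⊕ ⊖ b
⊖-distrib-⊕ 𝟎 b = refl
⊖-distrib-⊕ 𝟏 𝟎 = refl
⊖-distrib-⊕ 𝟏 𝟏 = refl
⊖-distrib-⊕ 𝟏 𝟐 = refl
⊖-distrib-⊕ 𝟐 𝟎 = refl
⊖-distrib-⊕ 𝟐 𝟏 = refl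
⊖-distrib-⊕ 𝟐 𝟐 = refl

⊖≢𝟎 : ∀ {a} → a ≢ 𝟎 → ⊖ a ≢ 𝟎
⊖≢𝟎 {𝟎} a≢0 _ = a≢0 refl
⊖≢𝟎 {𝟏} _ ()
⊖≢𝟎 {𝟐} _ ()

⊕-0-isCommutativeMonoid : IsCommutativeMonoid _≡_ _⊕_ 𝟎
⊕-0-isCommutativeMonoid = record
  { isMonoid = record
    { isSemigroup = record
      { isMagma = record { isEquivalence = isEquivalence ; ∙-cong = cong₂ _⊕_ }
      ; assoc = ⊕-assoc }
    ; identity = (λ _ → refl) , ⊕-identityʳ }
  ; comm = ⊕-comm }

module Σ₃ = FinSum ⊕-0-isCommutativeMonoid

sum-⊖ : ∀ {n} (f : Fin n → ℤ₃) → Σ₃.sum (λ i → ⊖ f i) ≡ ⊖ Σ₃.sum f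
sum-⊖ {zero} f = refl
sum-⊖ {suc n} f = trans (cong (⊖ f zero ⊕_) (sum-⊖ (f ∘ suc))) (sym (⊖-distrib-⊕ (f zero) _))

-- Quotients and double negation

record Quotient {n : ℕ} (_~_ : Fin n → Fin n → Set) : Set where
  field
    size    : ℕ
    class   : Fin n → Fin size
    rep     : Fin size → Fin n
    class-rep : ∀ i → class (rep i) ≡ i
    sound   : ∀ {u v} → u ~ v → class u ≡ class v
    exact   : ∀ {u v} → class u ≡ class v → u ~ v

-- Recursion on `n`: the point `zero` joins the class of an equivalent later point if there is one,
-- and opens a new class otherwise.
quotient : ∀ {n} (_~_ : Fin n → Fin n → Set) → (∀ u v → Dec (u ~ v)) →
  (∀ u → u ~ u) → (∀ {u v} → u ~ v → v ~ u) → (∀ {u v w} → u ~ v → v ~ w → u ~ w) →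
  Quotient _~_
quotient {zero} _~_ _ _ _ _ = record
  { size = 0 ; class = λ () ; rep = λ () ; class-rep = λ () ; sound = λ {u} → ⊥-elim (Finₚ.¬Fin0 u) ; exact = λ {u} → ⊥-elim (Finₚ.¬Fin0 u) }
quotient {suc n} _~_ _~?_ ~-refl ~-sym ~-trans with Finₚ.any? (λ v → zero ~? suc v)
... | yes (w , 0~w) = record
  { size = size ; class = class′ ; rep = suc ∘ rep ; class-rep = class-rep ; sound = sound′ ; exact = exact′ }
  where
  open Quotient (quotient (λ u v → suc u ~ suc v) (λ u v → suc u ~? suc v) (λ u → ~-refl (suc u)) ~-sym ~-trans)
  class′ : Fin (suc n) → Fin size
  class′ zero = class w
  class′ (suc v) = class v
  sound′ : ∀ {u v} → u ~ v → class′ u ≡ class′ v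
  sound′ {zero} {zero} _ = refl
  sound′ {zero} {suc v} e = sound (~-trans (~-sym 0~w) e)
  sound′ {suc u} {zero} e = sound (~-trans e 0~w)
  sound′ {suc u} {suc v} e = sound e
  exact′ : ∀ {u v} → class′ u ≡ class′ v → u ~ v
  exact′ {zero} {zero} _ = ~-refl _
  exact′ {zero} {suc v} e = ~-trans 0~w (exact e)
  exact′ {suc u} {zero} e = ~-trans (exact e) (~-sym 0~w)
  exact′ {suc u} {suc v} e = exact e
... | no ¬0~ = record
  { size = suc size ; class = class′ ; rep = rep′ ; class-rep = class-rep′ ; sound = sound′ ; exact = exact′ }
  where
  open Quotient (quotient (λ u v → suc u ~ suc v) (λ u v → suc u ~? suc v) (λ u → ~-refl (suc u)) ~-sym ~-trans)
  class′ : Fin (suc n) → Fin (suc size)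
  class′ zero = zero
  class′ (suc v) = suc (class v)
  rep′ : Fin (suc size) → Fin (suc n)
  rep′ zero = zero
  rep′ (suc i) = suc (rep i)
  class-rep′ : ∀ i → class′ (rep′ i) ≡ i
  class-rep′ zero = refl
  class-rep′ (suc i) = cong suc (class-rep i)
  sound′ : ∀ {u v} → u ~ v → class′ u ≡ class′ v
  sound′ {zero} {zero} _ = refl
  sound′ {zero} {suc v} e = contradiction (v , e) ¬0~
  sound′ {suc u} {zero} e = contradiction (u , ~-sym e) ¬0~
  sound′ {suc u} {suc v} e = cong suc (sound e)
  exact′ : ∀ {u v} → class′ u ≡ class′ v → u ~ v
  exact′ {zero} {zero} _ = ~-refl _
  exact′ {suc u} {suc v} e = exact (Finₚ.suc-injective e)

open RawMonad {f = 0ℓ} ¬¬-Monad using (_>>=_; pure)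

-- Finiteness lets double negation pass the quantifier, so excluded middle may be assumed for
-- finitely many propositions at once.
¬¬-all : ∀ {n} {P : Fin n → Set} → (∀ i → ¬ ¬ P i) → ¬ ¬ (∀ i → P i)
¬¬-all = Finₚ.sequence (RawMonad.rawApplicative ¬¬-Monad)

-- Signed graphs

lookup-unique : ∀ {A : Set} {xs : List A} → Unique xs → ∀ {i j} → i Fin.< j → lookup xs i ≢ lookup xs j
lookup-unique {xs = x ∷ xs} (x≢ ∷ _) {zero} {suc j} _ = All.lookup x≢ (∈-lookup j)
lookup-unique {xs = x ∷ xs} (_ ∷ u) {suc i} {suc j} (s≤s i<j) = lookup-unique u i<j

unique⇒length≤ : ∀ {N} {xs : List (Fin N)} → Unique xs → length xs ≤ N
unique⇒length≤ {N} {xs} u = ℕₚ.≮⇒≥ λ N<len →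
  let _ , _ , i<j , eq = Finₚ.pigeonhole N<len (lookup xs) in lookup-unique u i<j eq

-- A list without repetitions in `Fin N` has at most `N` entries, so `N` is enough fuel for the
-- enlargements.
grow-until : ∀ {N} (Good Done : List (Fin N) → Set) → (∀ {l} → Good l → Unique l) →
  (∀ l → Good l → Done l ⊎ ∃[ l′ ] (Good l′ × length l < length l′)) →
  ∀ l → Good l → ∃[ l′ ] (Good l′ × Done l′)
grow-until {N} Good Done uniq step l₀ g₀ = go N l₀ g₀ (ℕₚ.m≤m+n N (length l₀))
  where
  go : ∀ fuel l → Good l → N ≤ fuel + length l → ∃[ l′ ] (Good l′ × Done l′)
  go fuel l g le with step l g
  ... | inj₁ d = l , g , d
  go zero l g le | inj₂ (l′ , g′ , lt) =
    contradiction (ℕₚ.≤-trans (s≤s le) lt) (ℕₚ.≤⇒≯ (unique⇒length≤ (uniq g′)))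
  go (suc fuel) l g le | inj₂ (l′ , g′ , lt) = go fuel l′ g′
    (ℕₚ.≤-trans le (ℕₚ.≤-trans (ℕₚ.≤-reflexive (sym (ℕₚ.+-suc fuel _))) (ℕₚ.+-monoʳ-≤ fuel lt)))

exists-other : ∀ {N} (f : Fin N → ℕ) a → f a < Σℕ.sum f → ∃[ j ] (j ≢ a × 1 ≤ f j)
exists-other f a lt with Finₚ.any? (λ j → ¬? (j ≟ a) ×-dec (1 ℕ.≤? f j))
... | yes p = p
... | no ¬p = contradiction (Σℕ.sum-single f a λ v v≢a → ℕₚ.n<1⇒n≡0 (ℕₚ.≰⇒> λ le → ¬p (v , v≢a , le)))
                (λ eq → ℕₚ.<⇒≢ lt (sym eq))

exists-third : ∀ {N} (f : Fin N → ℕ) a c → a ≢ c → f a + f c < Σℕ.sum f →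
               ∃[ j ] (j ≢ a × j ≢ c × 1 ≤ f j)
exists-third {N} f a c a≢c lt =
  let j , j≢c , le = exists-other g c (ℕₚ.+-cancelˡ-< (f a) _ _ lt′) in j , ≢a j le , j≢c , subst (1 ≤_) (g≡ j (≢a j le)) le
  where
  -- With the value at `a` erased, a third point is just a point other than `c` in the support of
  -- `g`.
  g : Fin N → ℕ
  g v = f v Σℕ.when ⌊ ¬? (v ≟ a) ⌋
  ga≡0 : g a ≡ 0
  ga≡0 = Σℕ.when-no (¬? (a ≟ a)) (λ ¬r → ¬r refl)
  g≡ : ∀ v → v ≢ a → g v ≡ f v
  g≡ v v≢a = Σℕ.when-yes (¬? (v ≟ a)) v≢a
  ≢a : ∀ j → 1 ≤ g j → j ≢ a
  ≢a j le refl = contradiction (subst (1 ≤_) ga≡0 le) λ ()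
  lt′ : f a + g c < f a + Σℕ.sum g
  lt′ = subst₂ _<_ (cong (λ t → f a + t) (sym (g≡ c (a≢c ∘ sym))))
          (sym (trans (Σℕ.sum-update f g a g≡) (cong (_+ Σℕ.sum f) ga≡0))) lt

-- The residues that a sum of k signs ±1 can take.
Attainable : ℕ → ℤ₃ → Set
Attainable 0 t = t ≡ 𝟎
Attainable 1 t = t ≢ 𝟎
Attainable (suc (suc _)) _ = ⊤

Attainable-⊖ : ∀ k {t} → Attainable k t → Attainable k (⊖ t)
Attainable-⊖ 0 refl = refl
Attainable-⊖ 1 t≢0 = ⊖≢𝟎 t≢0
Attainable-⊖ (suc (suc _)) _ = tt

-- For two vertices of a signed graph, the first component is the total on
-- the positive edges between them and the second the total on the negative
-- ones, both seen from one of the two vertices.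
rev : ℤ₃ × ℤ₃ → ℤ₃ × ℤ₃
rev (x , y) = ⊖ x , y

rev-involutive : ∀ s → rev (rev s) ≡ s
rev-involutive (x , y) = cong (_, y) (⊖-involutive x)

κ : ℤ₃ × ℤ₃ → ℤ₃
κ (x , y) = x ⊕ y

Dom : ℕ → ℕ → ℤ₃ × ℤ₃ → Set
Dom m n (x , y) = Attainable m x × Attainable n y

Dom-rev : ∀ m n s → Dom m n s → Dom m n (rev s)
Dom-rev m n (x , y) (p , q) = Attainable-⊖ m p , q

-- The condition on the remaining sum β at one end of a pair joined by w edges
-- under which the pair can make both of its ends nonzero.
Ready : ℕ → ℤ₃ → Set
Ready 0 _ = ⊥
Ready 1 β = β ≡ 𝟎
Ready 2 β = β ≢ 𝟎
Ready (suc (suc (suc _))) _ = ⊤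

nonzero : ∀ k {t} → t ≢ 𝟎 → Attainable (suc k) t
nonzero zero t≢0 = t≢0
nonzero (suc _) _ = tt

-- A single edge already offers the two values 𝟏 and 𝟐, and at most one of them cancels `β`.
dodge : ∀ m n β → 1 ≤ m + n → ∃[ s ] (Dom m n s × β ⊕ κ s ≢ 𝟎)
dodge 0 0 _ ()
dodge 0 (suc n) 𝟎 _ = (𝟎 , 𝟏) , (refl , (nonzero n λ ())) , λ ()
dodge 0 (suc n) 𝟏 _ = (𝟎 , 𝟏) , (refl , (nonzero n λ ())) , λ ()
dodge 0 (suc n) 𝟐 _ = (𝟎 , 𝟐) , (refl , (nonzero n λ ())) , λ ()
dodge (suc m) 0 𝟎 _ = (𝟏 , 𝟎) , ((nonzero m λ ()) , refl) , λ ()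
dodge (suc m) 0 𝟏 _ = (𝟏 , 𝟎) , ((nonzero m λ ()) , refl) , λ ()
dodge (suc m) 0 𝟐 _ = (𝟐 , 𝟎) , ((nonzero m λ ()) , refl) , λ ()
dodge (suc m) (suc n) 𝟎 _ = (𝟏 , 𝟏) , ((nonzero m λ ()) , (nonzero n λ ())) , λ ()
dodge (suc m) (suc n) 𝟏 _ = (𝟏 , 𝟐) , ((nonzero m λ ()) , (nonzero n λ ())) , λ ()
dodge (suc m) (suc n) 𝟐 _ = (𝟏 , 𝟏) , ((nonzero m λ ()) , (nonzero n λ ())) , λ ()

-- A single edge can cancel any nonzero `β`; two edges can also contribute 𝟎.
hit : ∀ m n β → 1 ≤ m + n → β ≢ 𝟎 ⊎ 2 ≤ m + n → ∃[ s ] (Dom m n s × β ⊕ κ s ≡ 𝟎)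
hit 0 0 _ () _
hit 0 1 𝟎 _ (inj₁ 0≢0) = contradiction refl 0≢0
hit 0 1 𝟎 _ (inj₂ (s≤s ()))
hit 0 (suc (suc _)) 𝟎 _ _ = (𝟎 , 𝟎) , (refl , tt) , refl
hit 0 (suc n) 𝟏 _ _ = (𝟎 , 𝟐) , (refl , (nonzero n λ ())) , refl
hit 0 (suc n) 𝟐 _ _ = (𝟎 , 𝟏) , (refl , (nonzero n λ ())) , refl
hit 1 0 𝟎 _ (inj₁ 0≢0) = contradiction refl 0≢0
hit 1 0 𝟎 _ (inj₂ (s≤s ()))
hit (suc (suc _)) 0 𝟎 _ _ = (𝟎 , 𝟎) , (tt , refl) , refl
hit (suc m) 0 𝟏 _ _ = (𝟐 , 𝟎) , ((nonzero m λ ()) , refl) , refl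
hit (suc m) 0 𝟐 _ _ = (𝟏 , 𝟎) , ((nonzero m λ ()) , refl) , refl
hit (suc m) (suc n) 𝟎 _ _ = (𝟏 , 𝟐) , ((nonzero m λ ()) , (nonzero n λ ())) , refl
hit (suc m) (suc n) 𝟏 _ _ = (𝟏 , 𝟏) , ((nonzero m λ ()) , (nonzero n λ ())) , refl
hit (suc m) (suc n) 𝟐 _ _ = (𝟐 , 𝟐) , ((nonzero m λ ()) , (nonzero n λ ())) , refl

-- For a single edge, `β ≡ 𝟎` makes the first end nonzero whatever the sign, and the second end
-- forbids at most one sign. Two edges of the same sign realise all three residues, of which the two
-- ends forbid at most two. One positive and one negative edge fail only if `β` and `β′` both
-- vanish, which `Ready` excludes.
settle : ∀ m n β β′ → Ready (m + n) β → ∃[ s ] (Dom m n s × β ⊕ κ s ≢ 𝟎 × β′ ⊕ κ (rev s) ≢ 𝟎)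
settle 0 0 _ _ ()
settle 0 (suc n) 𝟎 𝟎 _ = (𝟎 , 𝟏) , (refl , (nonzero n λ ())) , (λ ()) , λ ()
settle 0 (suc n) 𝟎 𝟏 _ = (𝟎 , 𝟏) , (refl , (nonzero n λ ())) , (λ ()) , λ ()
settle 0 (suc n) 𝟎 𝟐 _ = (𝟎 , 𝟐) , (refl , (nonzero n λ ())) , (λ ()) , λ ()
settle 0 (suc n) 𝟏 𝟎 _ = (𝟎 , 𝟏) , (refl , (nonzero n λ ())) , (λ ()) , λ ()
settle 0 (suc n) 𝟏 𝟏 _ = (𝟎 , 𝟏) , (refl , (nonzero n λ ())) , (λ ()) , λ ()
settle 0 1 𝟏 𝟐 ()
settle 0 (suc (suc _)) 𝟏 𝟐 _ = (𝟎 , 𝟎) , (refl , tt) , (λ ()) , λ ()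
settle 0 (suc n) 𝟐 𝟎 _ = (𝟎 , 𝟐) , (refl , (nonzero n λ ())) , (λ ()) , λ ()
settle 0 1 𝟐 𝟏 ()
settle 0 (suc (suc _)) 𝟐 𝟏 _ = (𝟎 , 𝟎) , (refl , tt) , (λ ()) , λ ()
settle 0 (suc n) 𝟐 𝟐 _ = (𝟎 , 𝟐) , (refl , (nonzero n λ ())) , (λ ()) , λ ()
settle (suc m) 0 𝟎 𝟎 _ = (𝟏 , 𝟎) , ((nonzero m λ ()) , refl) , (λ ()) , λ ()
settle (suc m) 0 𝟎 𝟏 _ = (𝟐 , 𝟎) , ((nonzero m λ ()) , refl) , (λ ()) , λ ()
settle (suc m) 0 𝟎 𝟐 _ = (𝟏 , 𝟎) , ((nonzero m λ ()) , refl) , (λ ()) , λ ()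
settle (suc m) 0 𝟏 𝟎 _ = (𝟏 , 𝟎) , ((nonzero m λ ()) , refl) , (λ ()) , λ ()
settle 1 0 𝟏 𝟏 ()
settle (suc (suc _)) 0 𝟏 𝟏 _ = (𝟎 , 𝟎) , (tt , refl) , (λ ()) , λ ()
settle (suc m) 0 𝟏 𝟐 _ = (𝟏 , 𝟎) , ((nonzero m λ ()) , refl) , (λ ()) , λ ()
settle (suc m) 0 𝟐 𝟎 _ = (𝟐 , 𝟎) , ((nonzero m λ ()) , refl) , (λ ()) , λ ()
settle (suc m) 0 𝟐 𝟏 _ = (𝟐 , 𝟎) , ((nonzero m λ ()) , refl) , (λ ()) , λ ()
settle 1 0 𝟐 𝟐 ()
settle (suc (suc _)) 0 𝟐 𝟐 _ = (𝟎 , 𝟎) , (tt , refl) , (λ ()) , λ ()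
settle 1 1 𝟎 𝟎 0≢0 = contradiction refl 0≢0
settle 1 (suc (suc _)) 𝟎 𝟎 _ = (𝟏 , 𝟎) , ((λ ()) , tt) , (λ ()) , λ ()
settle (suc (suc _)) 1 𝟎 𝟎 _ = (𝟎 , 𝟏) , (tt , (λ ())) , (λ ()) , λ ()
settle (suc (suc _)) (suc (suc _)) 𝟎 𝟎 _ = (𝟎 , 𝟏) , (tt , tt) , (λ ()) , λ ()
settle (suc m) (suc n) 𝟎 𝟏 _ = (𝟏 , 𝟏) , ((nonzero m λ ()) , (nonzero n λ ())) , (λ ()) , λ ()
settle (suc m) (suc n) 𝟎 𝟐 _ = (𝟏 , 𝟏) , ((nonzero m λ ()) , (nonzero n λ ())) , (λ ()) , λ ()
settle (suc m) (suc n) 𝟏 𝟎 _ = (𝟏 , 𝟐) , ((nonzero m λ ()) , (nonzero n λ ())) , (λ ()) , λ ()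
settle (suc m) (suc n) 𝟏 𝟏 _ = (𝟏 , 𝟐) , ((nonzero m λ ()) , (nonzero n λ ())) , (λ ()) , λ ()
settle (suc m) (suc n) 𝟏 𝟐 _ = (𝟐 , 𝟏) , ((nonzero m λ ()) , (nonzero n λ ())) , (λ ()) , λ ()
settle (suc m) (suc n) 𝟐 𝟎 _ = (𝟏 , 𝟐) , ((nonzero m λ ()) , (nonzero n λ ())) , (λ ()) , λ ()
settle (suc m) (suc n) 𝟐 𝟏 _ = (𝟏 , 𝟏) , ((nonzero m λ ()) , (nonzero n λ ())) , (λ ()) , λ ()
settle (suc m) (suc n) 𝟐 𝟐 _ = (𝟏 , 𝟏) , ((nonzero m λ ()) , (nonzero n λ ())) , (λ ()) , λ ()

-- `a` counts the positive and `b` the negative edges. A positive edge contributes opposite amounts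
-- to its two ends, a negative edge equal amounts.
module SignedGraph {N : ℕ} (a b : Fin N → Fin N → ℕ)
  (a-sym : ∀ i j → a i j ≡ a j i) (b-sym : ∀ i j → b i j ≡ b j i)
  (a-irrefl : ∀ i → a i i ≡ 0) (b-irrefl : ∀ i → b i i ≡ 0) where

  open import Data.List.Membership.DecPropositional (Finₚ._≟_ {N}) using (_∈?_)

  State : Set
  State = Fin N → Fin N → ℤ₃ × ℤ₃

  record Valid (S : State) : Set where
    field
      reversal : ∀ i j → S j i ≡ rev (S i j)
      domain   : ∀ i j → Dom (a i j) (b i j) (S i j)
  open Valid public

  w : Fin N → Fin N → ℕ
  w i j = a i j + b i j

  w-irrefl : ∀ {i j} → 1 ≤ w i j → i ≢ j
  w-irrefl {i} le refl = contradiction (subst (1 ≤_) (cong₂ _+_ (a-irrefl i) (b-irrefl i)) le) λ ()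

  w-sym : ∀ i j → w i j ≡ w j i
  w-sym i j = cong₂ _+_ (a-sym i j) (b-sym i j)

  excess : State → Fin N → ℤ₃
  excess S i = Σ₃.sum (λ j → κ (S i j))

  -- The excess at `i` without the edges to `j`: the `β` to which `dodge`, `hit` and `settle` are
  -- applied.
  rest : State → Fin N → Fin N → ℤ₃
  rest S i j = ⊖ κ (S i j) ⊕ excess S i

  SameRow : State → State → Fin N → Set
  SameRow S S′ i = ∀ j → S′ i j ≡ S i j

  excess-cong : ∀ S S′ i → SameRow S S′ i → excess S′ i ≡ excess S i
  excess-cong S S′ i same = Σ₃.sum-cong-≗ λ j → cong κ (same j)

  rest-cong : ∀ S S′ i j → SameRow S S′ i → rest S′ i j ≡ rest S i j
  rest-cong S S′ i j same = cong₂ (λ s e → ⊖ κ s ⊕ e) (same j) (excess-cong S S′ i same)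

  record Update (S : State) (i j : Fin N) (s : ℤ₃ × ℤ₃) : Set where
    field
      state : State
      valid : Valid state
      new   : state i j ≡ s
      old   : ∀ k l → ¬ (k ≡ i × l ≡ j) → ¬ (k ≡ j × l ≡ i) → state k l ≡ S k l

  update : ∀ S i j s → Valid S → i ≢ j → Dom (a i j) (b i j) s → Update S i j s
  update S i j s vS i≢j ds = record { state = T ; valid = record { reversal = revT ; domain = domT } ; new = T-ij ; old = T-old }
    where
    T : State
    T k l with (k ≟ i) ×-dec (l ≟ j) | (k ≟ j) ×-dec (l ≟ i)
    ... | yes _ | _     = s
    ... | no _  | yes _ = rev s
    ... | no _  | no _  = S k l
    T-ij : T i j ≡ s
    T-ij with (i ≟ i) ×-dec (j ≟ j)
    ... | yes _ = refl
    ... | no ¬p = contradiction (refl , refl) ¬p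
    T-ji : T j i ≡ rev s
    T-ji with (j ≟ i) ×-dec (i ≟ j) | (j ≟ j) ×-dec (i ≟ i)
    ... | yes (j≡i , _) | _ = contradiction (sym j≡i) i≢j
    ... | no _ | yes _ = refl
    ... | no _ | no ¬p = contradiction (refl , refl) ¬p
    T-old : ∀ k l → ¬ (k ≡ i × l ≡ j) → ¬ (k ≡ j × l ≡ i) → T k l ≡ S k l
    T-old k l ¬ij ¬ji with (k ≟ i) ×-dec (l ≟ j) | (k ≟ j) ×-dec (l ≟ i)
    ... | yes p | _ = contradiction p ¬ij
    ... | no _ | yes p = contradiction p ¬ji
    ... | no _ | no _ = refl
    revT : ∀ k l → T l k ≡ rev (T k l)
    revT k l with (k ≟ i) ×-dec (l ≟ j) | (k ≟ j) ×-dec (l ≟ i)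
    ... | yes (refl , refl) | _ = T-ji
    ... | no _ | yes (refl , refl) = trans T-ij (sym (rev-involutive s))
    ... | no ¬p | no ¬q = trans (T-old l k (λ (p , q) → ¬q (q , p)) (λ (p , q) → ¬p (q , p))) (reversal vS k l)
    domT : ∀ k l → Dom (a k l) (b k l) (T k l)
    domT k l with (k ≟ i) ×-dec (l ≟ j) | (k ≟ j) ×-dec (l ≟ i)
    ... | yes (refl , refl) | _ = ds
    ... | no _ | yes (refl , refl) = subst₂ (λ m n → Dom m n (rev s)) (a-sym i j) (b-sym i j) (Dom-rev (a i j) (b i j) s ds)
    ... | no _ | no _ = domain vS k l

  module _ {S i j s} (i≢j : i ≢ j) (U : Update S i j s) where
    open Update U

    update-row : ∀ k → k ≢ i → k ≢ j → SameRow S state k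
    update-row k k≢i k≢j l = old k l (k≢i ∘ proj₁) (k≢j ∘ proj₁)

    private
      change : ∀ x y u v → x ⊕ u ≡ y ⊕ v → u ≡ (⊖ x ⊕ v) ⊕ y
      change x y u v eq = begin
        u               ≡⟨ cong (_⊕ u) (sym (⊕-inverseˡ x)) ⟩
        (⊖ x ⊕ x) ⊕ u  ≡⟨ ⊕-assoc (⊖ x) x u ⟩
        ⊖ x ⊕ (x ⊕ u)  ≡⟨ cong (⊖ x ⊕_) (trans eq (⊕-comm y v)) ⟩
        ⊖ x ⊕ (v ⊕ y)  ≡⟨ sym (⊕-assoc (⊖ x) v y) ⟩
        (⊖ x ⊕ v) ⊕ y  ∎
        where open ≡-Reasoning

    excess-update : excess state i ≡ rest S i j ⊕ κ s
    excess-update = change (κ (S i j)) (κ s) (excess state i) (excess S i)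
      (subst (λ t → κ (S i j) ⊕ excess state i ≡ κ t ⊕ excess S i) new
        (Σ₃.sum-update (λ l → κ (S i l)) (λ l → κ (state i l)) j
          λ l l≢j → cong κ (old i l (l≢j ∘ proj₂) (i≢j ∘ proj₁))))

    excess-updateʳ : excess state j ≡ rest S j i ⊕ κ (rev s)
    excess-updateʳ = change (κ (S j i)) (κ (rev s)) (excess state j) (excess S j)
      (subst (λ t → κ (S j i) ⊕ excess state j ≡ κ t ⊕ excess S j)
        (trans (reversal valid i j) (cong rev new))
        (Σ₃.sum-update (λ l → κ (S j l)) (λ l → κ (state j l)) i
          λ l l≢i → cong κ (old j l (i≢j ∘ sym ∘ proj₁) (l≢i ∘ proj₂))))

    rest-update : ∀ k → k ≢ j → rest state i k ≡ (⊖ κ (S i k)) ⊕ (rest S i j ⊕ κ s)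
    rest-update k k≢j = cong₂ (λ t e → ⊖ κ t ⊕ e) (old i k (k≢j ∘ proj₂) (i≢j ∘ proj₁)) excess-update

  -- Because the two ends of a pair determine each other's entries, fixing the rows outside `C` also
  -- fixes every edge that leaves `C`. Solvable sets can therefore be treated one after another.
  Solvable : List (Fin N) → Set
  Solvable C = ∀ S → Valid S → ∃[ S′ ] (Valid S′ × (∀ i → i ∉ C → SameRow S S′ i) × (∀ i → i ∈ C → excess S′ i ≢ 𝟎))

  solvable-[] : Solvable []
  solvable-[] S vS = S , vS , (λ _ _ _ → refl) , λ _ ()

  -- `v` is repaired first, through its edges to `u`. The disturbance at `u` does no harm, since `C`
  -- is repaired afterwards, and that leaves the row of `v` alone.
  solvable-∷ : ∀ {C} v u → v ∉ C → u ∈ C → 1 ≤ w v u → Solvable C → Solvable (v ∷ C)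
  solvable-∷ {C} v u v∉C u∈C le solve S vS =
    let s , ds , ≢0 = dodge (a v u) (b v u) (rest S v u) le
        U = update S v u s vS v≢u ds
        S₁ = Update.state U
        S₂ , vS₂ , same , good = solve S₁ (Update.valid U)
        v-good : excess S₂ v ≢ 𝟎
        v-good eq = ≢0 (trans (sym (trans (excess-cong S₁ S₂ v (same v v∉C)) (excess-update v≢u U))) eq)
    in S₂ , vS₂
     , (λ i i∉ j → trans (same i (i∉ ∘ there) j)
          (update-row v≢u U i (λ e → i∉ (here e)) (λ e → i∉ (there (subst (_∈ C) (sym e) u∈C))) j))
     , λ { i (here refl) → v-good ; i (there i∈C) → good i i∈C }
    where
    v≢u : v ≢ u
    v≢u = w-irrefl le

  solvable-++ : ∀ {C D} → (∀ {i} → i ∈ C → i ∉ D) → Solvable C → Solvable D → Solvable (C ++ D)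
  solvable-++ {C} {D} disj solveC solveD S vS =
    let S₁ , vS₁ , same₁ , good₁ = solveC S vS
        S₂ , vS₂ , same₂ , good₂ = solveD S₁ vS₁
        good : ∀ i → i ∈ C ++ D → excess S₂ i ≢ 𝟎
        good i i∈ eq = case (∈-++⁻ C i∈) of λ
          { (inj₁ i∈C) → good₁ i i∈C (trans (sym (excess-cong S₁ S₂ i (same₂ i (disj i∈C)))) eq)
          ; (inj₂ i∈D) → good₂ i i∈D eq }
    in S₂ , vS₂
     , (λ i i∉ j → trans (same₂ i (i∉ ∘ ∈-++⁺ʳ C) j) (same₁ i (i∉ ∘ ∈-++⁺ˡ) j))
     , good

  Adjacent : Fin N → Fin N → Set
  Adjacent i j = 1 ≤ w i j

  -- The repair runs from the far end of the path towards `x`, each vertex using the edges to its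
  -- predecessor, so the disturbance is pushed ahead until it stays at `x`.
  fix-tail : ∀ x xs → Unique (x ∷ xs) → Linked Adjacent (x ∷ xs) → ∀ S → Valid S →
    ∃[ S′ ] (Valid S′ × (∀ i → i ∉ x ∷ xs → SameRow S S′ i) × (∀ i → i ∈ xs → excess S′ i ≢ 𝟎))
  fix-tail x [] _ _ S vS = S , vS , (λ _ _ _ → refl) , λ _ ()
  fix-tail x (y ∷ ys) u@(_ ∷ uy) (adj ∷ link) S vS =
    let S₁ , vS₁ , same₁ , good₁ = fix-tail y ys uy link S vS
        s , ds , ≢0 = dodge (a y x) (b y x) (rest S₁ y x) (subst (1 ≤_) (w-sym x y) adj)
        U = update S₁ y x s vS₁ y≢x ds
        S₂ = Update.state U
        good : ∀ i → i ∈ y ∷ ys → excess S₂ i ≢ 𝟎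
        good = λ { i (here refl) eq → ≢0 (trans (sym (excess-update y≢x U)) eq)
                 ; i (there i∈) eq → good₁ i i∈ (trans (sym (excess-cong S₁ S₂ i
                     (update-row y≢x U i (λ { refl → Unique[x∷xs]⇒x∉xs uy i∈ }) (λ { refl → x∉ (there i∈) })))) eq) }
    in S₂ , Update.valid U
     , (λ i i∉ j → trans (update-row y≢x U i (λ e → i∉ (there (here e))) (λ e → i∉ (here e)) j) (same₁ i (i∉ ∘ there) j))
     , good
    where
    x∉ : x ∉ y ∷ ys
    x∉ = Unique[x∷xs]⇒x∉xs u
    y≢x : y ≢ x
    y≢x y≡x = x∉ (here (sym y≡x))

  -- Repair of a signed graph of minimum degree at least three

  module _ (degree≥3 : ∀ i → 3 ≤ Σℕ.sum (w i)) where


    -- All neighbours of `x` lie in `C` and are still to be repaired, so the edges from `x` to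
    -- vertices other than `y` can be spent on bringing `rest` at `x` into the form that `settle`
    -- needs.
    prepare : ∀ x y → Adjacent x y → ∀ {C} → (∀ j → Adjacent x j → j ∈ C) → x ∈ C → ∀ S → Valid S →
      ∃[ S′ ] (Valid S′ × (∀ i → i ∉ C → SameRow S S′ i) × Ready (w x y) (rest S′ x y))
    prepare x y adj {C} nbrs x∈C S vS with w x y in wxy
    prepare x y () nbrs x∈C S vS | 0
    prepare x y adj {C} nbrs x∈C S vS | 1 = one (exists-other (w x) y (subst (_< Σℕ.sum (w x)) (sym wxy) (ℕₚ.≤-trans (s≤s (s≤s z≤n)) (degree≥3 x))))
      where
      Goal : Set
      Goal = ∃[ S′ ] (Valid S′ × (∀ i → i ∉ C → SameRow S S′ i) × rest S′ x y ≡ 𝟎)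
      finish : ∀ S₁ → Valid S₁ → (∀ i → i ∉ C → SameRow S S₁ i) → ∀ j → j ≢ y → Adjacent x j →
        ⊖ κ (S₁ x y) ⊕ rest S₁ x j ≢ 𝟎 ⊎ 2 ≤ w x j → Goal
      finish S₁ vS₁ same₁ j j≢y adj-j cond =
        let x≢j = w-irrefl adj-j
            s , ds , ≡0 = hit (a x j) (b x j) (⊖ κ (S₁ x y) ⊕ rest S₁ x j) adj-j cond
            U = update S₁ x j s vS₁ x≢j ds
        in Update.state U , Update.valid U
         , (λ i i∉ k → trans (update-row x≢j U i (λ { refl → i∉ x∈C }) (λ { refl → i∉ (nbrs j adj-j) }) k) (same₁ i i∉ k))
         , trans (rest-update x≢j U y (j≢y ∘ sym)) (trans (sym (⊕-assoc (⊖ κ (S₁ x y)) (rest S₁ x j) (κ s))) ≡0)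
      one : ∃[ j ] (j ≢ y × 1 ≤ w x j) → Goal
      one (j , j≢y , adj-j) with 2 ℕ.≤? w x j
      ... | yes le = finish S vS (λ _ _ _ → refl) j j≢y adj-j (inj₂ le)
      -- Neither `y` nor `j` takes more than one edge at `x`, so there is a third neighbour `k`. The
      -- edge to `j` makes the amount to be cancelled nonzero, and then even a single edge to `k`
      -- can cancel it.
      ... | no ¬le =
        let k , k≢y , k≢j , adj-k = exists-third (w x) y j (j≢y ∘ sym)
              (ℕₚ.≤-trans (s≤s (ℕₚ.+-mono-≤ (ℕₚ.≤-reflexive wxy) (ℕ.s≤s⁻¹ (ℕₚ.≰⇒> ¬le)))) (degree≥3 x))
            x≢j = w-irrefl adj-j
            δ = ⊖ κ (S x y) ⊕ (⊖ κ (S x k) ⊕ rest S x j)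
            s , ds , ≢0 = dodge (a x j) (b x j) δ adj-j
            U = update S x j s vS x≢j ds
            S₁ = Update.state U
            y-old : S₁ x y ≡ S x y
            y-old = Update.old U x y (j≢y ∘ sym ∘ proj₂) (x≢j ∘ proj₁)
            eq : ⊖ κ (S₁ x y) ⊕ rest S₁ x k ≡ δ ⊕ κ s
            eq = begin
              ⊖ κ (S₁ x y) ⊕ rest S₁ x k
                ≡⟨ cong₂ (λ t e → ⊖ κ t ⊕ e) y-old (rest-update x≢j U k k≢j) ⟩
              ⊖ κ (S x y) ⊕ (⊖ κ (S x k) ⊕ (rest S x j ⊕ κ s))
                ≡⟨ cong (⊖ κ (S x y) ⊕_) (sym (⊕-assoc (⊖ κ (S x k)) (rest S x j) (κ s))) ⟩
              ⊖ κ (S x y) ⊕ ((⊖ κ (S x k) ⊕ rest S x j) ⊕ κ s)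
                ≡⟨ sym (⊕-assoc (⊖ κ (S x y)) _ (κ s)) ⟩
              δ ⊕ κ s ∎
        in finish S₁ (Update.valid U)
             (λ i i∉ → update-row x≢j U i (λ { refl → i∉ x∈C }) (λ { refl → i∉ (nbrs j adj-j) }))
             k k≢y adj-k (inj₁ λ e → ≢0 (trans (sym eq) e))
        where open ≡-Reasoning
    prepare x y adj {C} nbrs x∈C S vS | 2 =
      let j , j≢y , adj-j = exists-other (w x) y (subst (_< Σℕ.sum (w x)) (sym wxy) (degree≥3 x))
          x≢j = w-irrefl adj-j
          s , ds , ≢0 = dodge (a x j) (b x j) (⊖ κ (S x y) ⊕ rest S x j) adj-j
          U = update S x j s vS x≢j ds
      in Update.state U , Update.valid U
       , (λ i i∉ → update-row x≢j U i (λ { refl → i∉ x∈C }) (λ { refl → i∉ (nbrs j adj-j) }))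
       , λ e → ≢0 (trans (⊕-assoc (⊖ κ (S x y)) (rest S x j) (κ s)) (trans (sym (rest-update x≢j U y (j≢y ∘ sym))) e))
    prepare x y adj nbrs x∈C S vS | suc (suc (suc _)) = S , vS , (λ _ _ _ → refl) , tt

    -- The edges between `x` and `y` are saved for the end, where `settle` repairs both vertices.
    -- The repair of `ys` in between does not touch the row of `x`, so the prepared condition
    -- survives.
    solvable-path : ∀ x y ys → Unique (x ∷ y ∷ ys) → Linked Adjacent (x ∷ y ∷ ys) →
      (∀ j → Adjacent x j → j ∈ x ∷ y ∷ ys) → Solvable (x ∷ y ∷ ys)
    solvable-path x y ys u@(_ ∷ uy) (adj ∷ link) nbrs S vS =
      let S₁ , vS₁ , same₁ , ready = prepare x y adj nbrs (here refl) S vS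
          S₂ , vS₂ , same₂ , good₂ = fix-tail y ys uy link S₁ vS₁
          s , ds , x≢0 , y≢0 = settle (a x y) (b x y) (rest S₂ x y) (rest S₂ y x)
            (subst (Ready (w x y)) (sym (rest-cong S₁ S₂ x y (same₂ x x∉))) ready)
          U = update S₂ x y s vS₂ x≢y ds
          S₃ = Update.state U
          good : ∀ i → i ∈ x ∷ y ∷ ys → excess S₃ i ≢ 𝟎
          good = λ { i (here refl) eq → x≢0 (trans (sym (excess-update x≢y U)) eq)
                   ; i (there (here refl)) eq → y≢0 (trans (sym (excess-updateʳ x≢y U)) eq)
                   ; i (there (there i∈)) eq → good₂ i i∈ (trans (sym (excess-cong S₂ S₃ i
                       (update-row x≢y U i (λ { refl → x∉ (there i∈) }) (λ { refl → Unique[x∷xs]⇒x∉xs uy i∈ })))) eq) }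
      in S₃ , Update.valid U
       , (λ i i∉ j → trans (update-row x≢y U i (λ e → i∉ (here e)) (λ e → i∉ (there (here e))) j)
            (trans (same₂ i (i∉ ∘ there) j) (same₁ i i∉ j)))
       , good
      where
      x∉ : x ∉ y ∷ ys
      x∉ = Unique[x∷xs]⇒x∉xs u
      x≢y : x ≢ y
      x≢y = w-irrefl adj

    -- A path outside `C` is prolonged at its head until every neighbour of the head lies on it; no
    -- edge can lead from it into `C`. A single vertex is never maximal, because its degree gives it
    -- a neighbour.
    maximal-path : ∀ C v → v ∉ C → (∀ i j → i ∉ C → Adjacent i j → j ∉ C) →
      ∃[ p ] (Unique p × Solvable p × (∀ {i} → i ∈ p → i ∉ C) × 1 ≤ length p)
    maximal-path C v v∉C closed with grow-until Path Maximal (proj₁ ∘ proj₂) step (v ∷ []) start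
      where
      Path : List (Fin N) → Set
      Path p = (1 ≤ length p) × Unique p × Linked Adjacent p × (∀ {i} → i ∈ p → i ∉ C)
      Maximal : List (Fin N) → Set
      Maximal p = ∀ x xs → p ≡ x ∷ xs → ∀ j → Adjacent x j → j ∈ p
      start : Path (v ∷ [])
      start = s≤s z≤n , ([] ∷ []) , [-] , λ { (here refl) → v∉C }
      step : ∀ p → Path p → Maximal p ⊎ ∃[ p′ ] (Path p′ × length p < length p′)
      step (x ∷ xs) (_ , u , link , out) with Finₚ.any? (λ j → (1 ℕ.≤? w x j) ×-dec ¬? (j ∈? (x ∷ xs)))
      ... | yes (j , adj , j∉) = inj₂ (j ∷ x ∷ xs , (s≤s z≤n , (¬Any⇒All¬ _ j∉ ∷ u) , (subst (1 ≤_) (w-sym x j) adj ∷ link)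
              , λ { (here refl) → closed x j (out (here refl)) adj ; (there i∈) → out i∈ }) , ℕₚ.≤-refl)
      ... | no none = inj₁ λ { _ _ refl j adj → decidable-stable (j ∈? (x ∷ xs)) λ j∉ → none (j , adj , j∉) }
    ... | [] , (() , _) , _
    ... | x ∷ [] , (_ , u , link , out) , maximal =
      let j , j≢x , adj = exists-other (w x) x (subst (_< Σℕ.sum (w x)) (sym (cong₂ _+_ (a-irrefl x) (b-irrefl x)))
                            (ℕₚ.≤-trans (s≤s z≤n) (degree≥3 x)))
      in case maximal x [] refl j adj of λ { (here j≡x) → contradiction j≡x j≢x }
    ... | x ∷ y ∷ ys , (le , u , link , out) , maximal =
      x ∷ y ∷ ys , u , solvable-path x y ys u link (maximal x (y ∷ ys) refl) , out , le

    -- The solvable set grows by a vertex adjacent to it or, if there is none, by a maximal path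
    -- outside it, until it contains all vertices.
    nowhere-zero-excess : ∀ S → Valid S → ∃[ S′ ] (Valid S′ × (∀ i → excess S′ i ≢ 𝟎))
    nowhere-zero-excess S vS with grow-until Good Full proj₁ step [] ([] , solvable-[])
      where
      Good Full : List (Fin N) → Set
      Good C = Unique C × Solvable C
      Full C = ∀ i → i ∈ C
      step : ∀ C → Good C → Full C ⊎ ∃[ C′ ] (Good C′ × length C < length C′)
      step C (u , solve) with Finₚ.any? (λ v → ¬? (v ∈? C))
      ... | no none = inj₁ λ i → decidable-stable (i ∈? C) λ i∉ → none (i , i∉)
      ... | yes (v , v∉C) with Finₚ.any? (λ i → Finₚ.any? (λ j → ¬? (i ∈? C) ×-dec (1 ℕ.≤? w i j) ×-dec (j ∈? C)))
      ...   | yes (i , j , i∉C , adj , j∈C) =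
        inj₂ (i ∷ C , ((¬Any⇒All¬ _ i∉C ∷ u) , solvable-∷ i j i∉C j∈C adj solve) , ℕₚ.≤-refl)
      ...   | no none =
        let p , up , solve-p , out , le = maximal-path C v v∉C (λ i j i∉ adj j∈ → none (i , j , i∉ , adj , j∈))
        in inj₂ (p ++ C , (++⁺ up u (λ (i∈p , i∈C) → out i∈p i∈C) , solvable-++ out solve-p solve)
             , subst (length C <_) (sym (Listₚ.length-++ p)) (ℕₚ.+-monoˡ-≤ (length C) le))
    ... | C , (_ , solve) , full = let S′ , vS′ , _ , good = solve S vS in S′ , vS′ , λ i → good i (full i)

-- Central involutions of nilpotent permutation groups

iter : {A : Set} → (A → A) → ℕ → A → A
iter f zero v = v
iter f (suc k) v = f (iter f k v)

iter-+ : ∀ {A : Set} (f : A → A) j k v → iter f (j + k) v ≡ iter f j (iter f k v)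
iter-+ f zero k v = refl
iter-+ f (suc j) k v = cong f (iter-+ f j k v)

halve : ∀ n → ∃[ m ] (n ≡ m + m ⊎ n ≡ suc (m + m))
halve zero = 0 , inj₁ refl
halve (suc n) with halve n
... | m , inj₁ e = m , inj₂ (cong suc e)
... | m , inj₂ e = suc m , inj₁ (cong suc (trans e (sym (ℕₚ.+-suc m m))))

-- Among `n ^ n + 1` iterates two agree as functions, `funToFin` numbering the self-maps;
-- injectivity cancels the smaller exponent.
injective⇒periodic : ∀ {n} (f : Fin n → Fin n) → (∀ {u v} → f u ≡ f v → u ≡ v) →
  ∃[ k ] (∀ v → iter f (suc k) v ≡ v)
injective⇒periodic {n} f inj =
  let i , j , i<j , eq = Finₚ.pigeonhole (ℕₚ.n<1+n (n ^ n)) (λ k → funToFin (iter f (toℕ k)))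
      k , j≡ = ℕₚ.m≤n⇒∃[o]m+o≡n i<j
  in k , λ v → cancel (toℕ i) (trans (sym (iter-+ f (toℕ i) (suc k) v))
       (trans (cong (λ m → iter f m v) (trans (ℕₚ.+-suc (toℕ i) k) j≡)) (sym (pointwise eq v))))
  where
  cancel : ∀ i {u v} → iter f i u ≡ iter f i v → u ≡ v
  cancel zero e = e
  cancel (suc i) e = cancel i (inj e)
  pointwise : ∀ {g h : Fin n → Fin n} → funToFin g ≡ funToFin h → ∀ v → g v ≡ h v
  pointwise {g} {h} e v = trans (sym (Finₚ.finToFun-funToFin g v))
    (trans (cong (λ m → finToFun m v) e) (Finₚ.finToFun-funToFin h v))

module NilpotentAction {X : Set} (_·_ : X → X → X) (_⁻¹ : X → X) where

  [_,_] : X → X → X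
  [ x , y ] = (((x ⁻¹) · (y ⁻¹)) · x) · y

  -- `X` enters only through its effect on points, so the same `X` can act again, possibly less
  -- faithfully, on the blocks of a quotient.
  record Action (n : ℕ) : Set where
    field
      act        : X → Fin n → Fin n
      act-·      : ∀ x y v → act (x · y) v ≡ act y (act x v)
      act-⁻¹ˡ    : ∀ x v → act (x ⁻¹) (act x v) ≡ v
      act-⁻¹ʳ    : ∀ x v → act x (act (x ⁻¹) v) ≡ v
      transitive : ∀ u v → ∃[ x ] act x u ≡ v

  module ActionProperties {n : ℕ} (A : Action n) where
    open Action A public

    -- The upper central series of the permutation group induced on the points: triviality is judged
    -- by the action.
    Z : ℕ → X → Set
    Z zero    x = ∀ v → act x v ≡ v
    Z (suc i) x = ∀ y → Z i [ x , y ]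

    trivial? : ∀ x → Dec (Z 0 x)
    trivial? x = Finₚ.all? (λ v → act x v ≟ v)

    perm : X → Permutation′ n
    perm x = permutation (act x) (act (x ⁻¹)) (act-⁻¹ʳ x) (act-⁻¹ˡ x)

    act-injective : ∀ x {u v} → act x u ≡ act x v → u ≡ v
    act-injective x {u} {v} e = trans (sym (act-⁻¹ˡ x u)) (trans (cong (act (x ⁻¹)) e) (act-⁻¹ˡ x v))

    act-inverse : ∀ x {u v} → act x u ≡ v → act (x ⁻¹) v ≡ u
    act-inverse x {u} refl = act-⁻¹ˡ x u

    act-commutator : ∀ x y v → act [ x , y ] v ≡ act y (act x (act (y ⁻¹) (act (x ⁻¹) v)))
    act-commutator x y v = trans (act-· _ y v) (cong (act y)
      (trans (act-· _ x v) (cong (act x) (act-· (x ⁻¹) (y ⁻¹) v))))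

    -- Exponents are shifted by one: `power x k` is the power of `x` with exponent k + 1.
    power : X → ℕ → X
    power x zero = x
    power x (suc k) = power x k · x

    act-power : ∀ x k v → act (power x k) v ≡ iter (act x) (suc k) v
    act-power x zero v = refl
    act-power x (suc k) v = trans (act-· (power x k) x v) (cong (act x) (act-power x k v))

    Involution : X → Set
    Involution z = ¬ Z 0 z × (∀ v → act z (act z v) ≡ v)

    Commuting : X → Set
    Commuting z = ∀ y v → act y (act z v) ≡ act z (act y v)

    -- Halving an even period until the power is nontrivial.
    swap⇒involution : ∀ x {u v} → u ≢ v → act x u ≡ v → act x v ≡ u → ∃ Involution
    swap⇒involution x {u} {v} u≢v xu xv =
      let k , period = injective⇒periodic (act x) (act-injective x) in go (suc k) (<-wellFounded _) (s≤s z≤n) period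
      where
      even-power : ∀ m → iter (act x) (m + m) u ≡ u
      even-power zero = refl
      even-power (suc m) = begin
        iter (act x) (suc (m + suc m)) u     ≡⟨ cong (λ l → iter (act x) (suc l) u) (ℕₚ.+-suc m m) ⟩
        act x (act x (iter (act x) (m + m) u)) ≡⟨ cong (act x ∘ act x) (even-power m) ⟩
        act x (act x u)                      ≡⟨ trans (cong (act x) xu) xv ⟩
        u ∎
        where open ≡-Reasoning
      go : ∀ N → Acc _<_ N → 1 ≤ N → (∀ w → iter (act x) N w ≡ w) → ∃ Involution
      go N _ 1≤N period with halve N
      -- An odd period is impossible: even powers of `x` fix `u`, so odd ones move it to `v`.
      go .(suc (m + m)) _ 1≤N period | m , inj₂ refl =
        contradiction (trans (sym (period u)) (trans (cong (act x) (even-power m)) xu)) u≢v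
      go .(suc m + suc m) (acc smaller) 1≤N period | suc m , inj₁ refl with trivial? (power x m)
      ... | yes triv = go (suc m) (smaller (s≤s (ℕₚ.m≤n+m (suc m) m))) (s≤s z≤n)
                          (λ w → trans (sym (act-power x m w)) (triv w))
      ... | no ¬triv = power x m , ¬triv , λ w →
        trans (trans (act-power x m _) (cong (iter (act x) (suc m)) (act-power x m w)))
              (trans (sym (iter-+ (act x) (suc m) (suc m) w)) (period w))

    _Inverts_ : X → X → Set
    x Inverts w = ∀ v → act x (act w (act (x ⁻¹) v)) ≡ act (w ⁻¹) v

    -- If x inverts w, then [ w , x ] acts as w⁻² and is again inverted by x; if w is an
    -- involution, then w inverts [ w , y ].  Either way the position in the central series drops.
    central-involution : ∀ i w x → Z i w → ¬ Z 0 w → x Inverts w →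
                         ¬ ¬ (∃[ z ] (Involution z × Commuting z))
    central-involution zero w x triv ¬triv _ = contradiction triv ¬triv
    central-involution (suc i) w x w∈Z ¬triv inverts with Finₚ.all? (λ v → act w (act w v) ≟ v)
    ... | no ¬invol = central-involution i c x (w∈Z x) ¬trivial x-inverts
      where
      c : X
      c = [ w , x ]
      W W⁻ X⁺ X⁻ : Fin n → Fin n
      W = act w
      W⁻ = act (w ⁻¹)
      X⁺ = act x
      X⁻ = act (x ⁻¹)
      act-c : ∀ v → act c v ≡ W⁻ (W⁻ v)
      act-c v = trans (act-commutator w x v) (inverts (W⁻ v))
      act-c⁻ : ∀ v → act (c ⁻¹) v ≡ W (W v)
      act-c⁻ v = act-inverse c (trans (act-c (W (W v))) (trans (cong W⁻ (act-⁻¹ˡ w (W v))) (act-⁻¹ˡ w v)))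
      conj : ∀ v → X⁺ (W⁻ (X⁻ v)) ≡ W v
      conj v = trans (cong (X⁺ ∘ W⁻) (act-inverse x (trans (inverts (W v)) (act-⁻¹ˡ w v))))
                     (trans (cong X⁺ (act-⁻¹ˡ w _)) (act-⁻¹ʳ x (W v)))
      x-inverts : x Inverts c
      x-inverts v = begin
        X⁺ (act c (X⁻ v))         ≡⟨ cong X⁺ (act-c (X⁻ v)) ⟩
        X⁺ (W⁻ (W⁻ (X⁻ v)))       ≡⟨ cong (X⁺ ∘ W⁻) (sym (act-⁻¹ˡ x _)) ⟩
        X⁺ (W⁻ (X⁻ (X⁺ (W⁻ (X⁻ v))))) ≡⟨ conj _ ⟩
        W (X⁺ (W⁻ (X⁻ v)))        ≡⟨ cong W (conj v) ⟩
        W (W v)                   ≡⟨ sym (act-c⁻ v) ⟩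
        act (c ⁻¹) v ∎
        where open ≡-Reasoning
      ¬trivial : ¬ Z 0 c
      ¬trivial triv = ¬invol λ v → trans (sym (act-c⁻ v)) (act-inverse c (triv v))
    -- If all commutators with `w` act trivially, `w` itself is central in its action. As `X` is an
    -- arbitrary set, the alternative is decided only under a double negation.
    ... | yes invol = ¬¬-excluded-middle {A = ∃[ y ] (¬ Z 0 [ w , y ])} >>= λ
      { (yes (y , ¬trivial)) → central-involution i [ w , y ] w (w∈Z y) ¬trivial (w-inverts y)
      ; (no all-trivial) → pure (w , (¬triv , invol) , λ y v →
          commute y v (decidable-stable (trivial? [ w , y ]) (λ ¬t → all-trivial (y , ¬t)))) }
      where
      W⁻≡W : ∀ v → act (w ⁻¹) v ≡ act w v
      W⁻≡W v = act-inverse w (invol v)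
      commute : ∀ y v → Z 0 [ w , y ] → act y (act w v) ≡ act w (act y v)
      commute y v triv = begin
        act y (act w v)
          ≡⟨ cong (act y ∘ act w) (sym (trans (cong (act (y ⁻¹)) (act-⁻¹ˡ w _)) (act-⁻¹ˡ y v))) ⟩
        act y (act w (act (y ⁻¹) (act (w ⁻¹) (act w (act y v)))))
          ≡⟨ sym (act-commutator w y _) ⟩
        act [ w , y ] (act w (act y v))
          ≡⟨ triv _ ⟩
        act w (act y v) ∎
        where open ≡-Reasoning
      w-inverts : ∀ y → w Inverts [ w , y ]
      w-inverts y v = begin
        act w (act [ w , y ] (act (w ⁻¹) v))
          ≡⟨ cong (act w) (act-commutator w y _) ⟩
        act w (act y (act w (act (y ⁻¹) (act (w ⁻¹) (act (w ⁻¹) v)))))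
          ≡⟨ cong (act w ∘ act y ∘ act w ∘ act (y ⁻¹)) (trans (cong (act (w ⁻¹)) (W⁻≡W v)) (act-⁻¹ˡ w v)) ⟩
        act w (act y (act w (act (y ⁻¹) v)))
          ≡⟨ sym (act-inverse [ w , y ] (trans (act-commutator w y _) undo)) ⟩
        act ([ w , y ] ⁻¹) v ∎
        where
        open ≡-Reasoning
        undo : act y (act w (act (y ⁻¹) (act (w ⁻¹) (act w (act y (act w (act (y ⁻¹) v))))))) ≡ v
        undo = begin
          act y (act w (act (y ⁻¹) (act (w ⁻¹) (act w (act y (act w (act (y ⁻¹) v)))))))
            ≡⟨ cong (act y ∘ act w ∘ act (y ⁻¹)) (act-⁻¹ˡ w _) ⟩
          act y (act w (act (y ⁻¹) (act y (act w (act (y ⁻¹) v)))))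
            ≡⟨ cong (act y ∘ act w) (act-⁻¹ˡ y _) ⟩
          act y (act w (act w (act (y ⁻¹) v)))
            ≡⟨ cong (act y) (invol _) ⟩
          act y (act (y ⁻¹) v)
            ≡⟨ act-⁻¹ʳ y v ⟩
          v ∎

    -- An involution acts as its own inverse and so is inverted by itself, which starts the descent.
    swap⇒central-involution : ∀ {c} → (∀ x → Z c x) → ∀ x {u v} → u ≢ v → act x u ≡ v → act x v ≡ u →
                              ¬ ¬ (∃[ z ] (Involution z × Commuting z))
    swap⇒central-involution {c} nilpotent x u≢v xu xv =
      let w , ¬triv , invol = swap⇒involution x u≢v xu xv
      in central-involution c w w (nilpotent w) ¬triv
           (λ v → trans (cong (act w) (act-⁻¹ʳ w v)) (sym (act-inverse w (invol v))))

-- Signs and integer representatives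

sgn : ∀ {n} → Fin n → Fin n → ℤ₃
sgn i j with Finₚ.<-cmp i j
... | tri< _ _ _ = 𝟏
... | tri≈ _ _ _ = 𝟎
... | tri> _ _ _ = 𝟐

sgn-antisym : ∀ {n} (i j : Fin n) → sgn j i ≡ ⊖ sgn i j
sgn-antisym i j with Finₚ.<-cmp i j | Finₚ.<-cmp j i
... | tri< _ _ _ | tri> _ _ _ = refl
... | tri≈ _ _ _ | tri≈ _ _ _ = refl
... | tri> _ _ _ | tri< _ _ _ = refl
... | tri< _ _ j≮i | tri< j<i _ _ = contradiction j<i j≮i
... | tri< _ i≢j _ | tri≈ _ j≡i _ = contradiction (sym j≡i) i≢j
... | tri≈ _ i≡j _ | tri< _ j≢i _ = contradiction (sym i≡j) j≢i
... | tri≈ _ i≡j _ | tri> _ j≢i _ = contradiction (sym i≡j) j≢i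
... | tri> _ i≢j _ | tri≈ _ j≡i _ = contradiction (sym j≡i) i≢j
... | tri> i≮j _ _ | tri> _ _ i<j = contradiction i<j i≮j

sgn≢𝟎 : ∀ {n} {i j : Fin n} → i ≢ j → sgn i j ≢ 𝟎
sgn≢𝟎 {i = i} {j} i≢j with Finₚ.<-cmp i j
... | tri< _ _ _ = λ ()
... | tri≈ _ i≡j _ = contradiction i≡j i≢j
... | tri> _ _ _ = λ ()

-- The representatives of least absolute value, so that negation is respected.
toℤ : ℤ₃ → ℤ
toℤ 𝟎 = + 0
toℤ 𝟏 = + 1
toℤ 𝟐 = -[1+ 0 ]

toℤ-⊖ : ∀ a → toℤ (⊖ a) ≡ ℤ.- toℤ a
toℤ-⊖ 𝟎 = refl
toℤ-⊖ 𝟏 = refl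
toℤ-⊖ 𝟐 = refl

toℤ-⊕ : ∀ a b → ∃[ t ] toℤ a ℤ.+ toℤ b ≡ + 3 ℤ.* t ℤ.+ toℤ (a ⊕ b)
toℤ-⊕ 𝟎 b = + 0 , refl
toℤ-⊕ 𝟏 𝟎 = + 0 , refl
toℤ-⊕ 𝟏 𝟏 = + 1 , refl
toℤ-⊕ 𝟏 𝟐 = + 0 , refl
toℤ-⊕ 𝟐 𝟎 = + 0 , refl
toℤ-⊕ 𝟐 𝟏 = + 0 , refl
toℤ-⊕ 𝟐 𝟐 = -[1+ 0 ] , refl

sum-toℤ : ∀ {n} (f : Fin n → ℤ₃) →
  ∃[ t ] Σℤ.sum (toℤ ∘ f) ≡ + 3 ℤ.* t ℤ.+ toℤ (Σ₃.sum f)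
sum-toℤ {zero} f = + 0 , refl
sum-toℤ {suc n} f =
  let t , eq = sum-toℤ (f ∘ suc)
      t′ , eq′ = toℤ-⊕ (f zero) (Σ₃.sum (f ∘ suc))
      x = toℤ (f zero)
      y = toℤ (Σ₃.sum (f ∘ suc))
      z = toℤ (Σ₃.sum f)
  in t ℤ.+ t′ , (begin
    x ℤ.+ Σℤ.sum (toℤ ∘ f ∘ suc)       ≡⟨ cong (λ s → x ℤ.+ s) eq ⟩
    x ℤ.+ (+ 3 ℤ.* t ℤ.+ y)             ≡⟨ swap x t y ⟩
    + 3 ℤ.* t ℤ.+ (x ℤ.+ y)             ≡⟨ cong (λ s → + 3 ℤ.* t ℤ.+ s) eq′ ⟩
    + 3 ℤ.* t ℤ.+ (+ 3 ℤ.* t′ ℤ.+ z)    ≡⟨ gather t t′ z ⟩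
    + 3 ℤ.* (t ℤ.+ t′) ℤ.+ z ∎)
  where
  open ≡-Reasoning
  swap : ∀ x t y → x ℤ.+ (+ 3 ℤ.* t ℤ.+ y) ≡ + 3 ℤ.* t ℤ.+ (x ℤ.+ y)
  swap = solve-∀
  gather : ∀ t t′ z → + 3 ℤ.* t ℤ.+ (+ 3 ℤ.* t′ ℤ.+ z) ≡ + 3 ℤ.* (t ℤ.+ t′) ℤ.+ z
  gather = solve-∀

3t+unit≢0 : ∀ t s → ℤ.∣ s ∣ ≡ 1 → + 0 ≢ + 3 ℤ.* t ℤ.+ s
3t+unit≢0 t s ∣s∣≡1 eq = contradiction (ℕₚ.m*n≡1⇒m≡1 3 ℤ.∣ t ∣ 3∣t∣≡1) λ ()
  where
  3t≡-s : + 3 ℤ.* t ≡ ℤ.- s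
  3t≡-s = trans (isolate t s) (trans (cong (λ x → x ℤ.- s) (sym eq)) (ℤₚ.+-identityˡ (ℤ.- s)))
    where
    isolate : ∀ t s → + 3 ℤ.* t ≡ (+ 3 ℤ.* t ℤ.+ s) ℤ.- s
    isolate = solve-∀
  3∣t∣≡1 : 3 ℕ.* ℤ.∣ t ∣ ≡ 1
  3∣t∣≡1 = trans (sym (ℤₚ.abs-* (+ 3) t)) (trans (cong ℤ.∣_∣ 3t≡-s) (trans (ℤₚ.∣-i∣≡∣i∣ s) ∣s∣≡1))

sum-toℤ≡0⇒sum≡𝟎 : ∀ {n} (f : Fin n → ℤ₃) → Σℤ.sum (toℤ ∘ f) ≡ + 0 → Σ₃.sum f ≡ 𝟎
sum-toℤ≡0⇒sum≡𝟎 f eq with Σ₃.sum f | sum-toℤ f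
... | 𝟎 | _ = refl
... | 𝟏 | t , eq′ = contradiction (trans (sym eq) eq′) (3t+unit≢0 t (+ 1) refl)
... | 𝟐 | t , eq′ = contradiction (trans (sym eq) eq′) (3t+unit≢0 t -[1+ 0 ] refl)

sumℤ-neg : ∀ {n} (f : Fin n → ℤ) → Σℤ.sum (λ i → ℤ.- f i) ≡ ℤ.- Σℤ.sum f
sumℤ-neg {zero} f = refl
sumℤ-neg {suc n} f = trans (cong (λ t → ℤ.- f zero ℤ.+ t) (sumℤ-neg (f ∘ suc))) (sym (ℤₚ.neg-distrib-+ (f zero) _))

sumℤ-const : ∀ n c → Σℤ.sum {n} (λ _ → c) ≡ + n ℤ.* c
sumℤ-const zero c = sym (ℤₚ.*-zeroˡ c)
sumℤ-const (suc n) c = trans (cong (λ s → c ℤ.+ s) (sumℤ-const n c)) (sym (ℤₚ.suc-* (+ n) c))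

self-negative : ∀ {x} → x ≡ ℤ.- x → x ≡ + 0
self-negative {+ zero} _ = refl
self-negative {+ suc _} ()
self-negative { -[1+ _ ]} ()

sum-antisymmetric : ∀ {n} (f : Fin n → Fin n → ℤ) → (∀ u v → f v u ≡ ℤ.- f u v) →
  Σℤ.sum (λ u → Σℤ.sum (f u)) ≡ + 0
sum-antisymmetric f anti = self-negative (begin
  Σℤ.sum (λ u → Σℤ.sum (λ v → f u v))       ≡⟨ Σℤ.∑-comm f ⟩
  Σℤ.sum (λ v → Σℤ.sum (λ u → f u v))       ≡⟨ Σℤ.sum-cong-≗ (λ v → Σℤ.sum-cong-≗ (λ u → anti v u)) ⟩
  Σℤ.sum (λ v → Σℤ.sum (λ u → ℤ.- f v u))   ≡⟨ Σℤ.sum-cong-≗ (λ v → sumℤ-neg (f v)) ⟩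
  Σℤ.sum (λ v → ℤ.- Σℤ.sum (f v))           ≡⟨ sumℤ-neg (λ v → Σℤ.sum (f v)) ⟩
  ℤ.- Σℤ.sum (λ v → Σℤ.sum (f v)) ∎)
  where open ≡-Reasoning

-- Nowhere-zero flows modulo 3

-- μ u v is the number of edges joining u and v, and flow u v the total
-- value modulo 3 sent from u to v along them.
record Flow₃ {n : ℕ} (μ : Fin n → Fin n → ℕ) : Set where
  field
    flow       : Fin n → Fin n → ℤ₃
    antisym    : ∀ u v → flow v u ≡ ⊖ flow u v
    attainable : ∀ u v → Attainable (μ u v) (flow u v)
    balanced   : ∀ u → Σ₃.sum (flow u) ≡ 𝟎

signed : Bool → ℤ₃ → ℤ₃
signed true t = t
signed false t = ⊖ t

same : Bool → Bool → Bool
same true b = b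
same false b = not b

signed-⊖ : ∀ b t → signed b (⊖ t) ≡ ⊖ signed b t
signed-⊖ true t = refl
signed-⊖ false t = refl

signed-not : ∀ b t → signed (not b) t ≡ ⊖ signed b t
signed-not true t = refl
signed-not false t = sym (⊖-involutive t)

signed≢𝟎 : ∀ b {t} → t ≢ 𝟎 → signed b t ≢ 𝟎
signed≢𝟎 true ≢0 = ≢0
signed≢𝟎 false ≢0 = ⊖≢𝟎 ≢0

same-comm : ∀ b b′ → same b b′ ≡ same b′ b
same-comm true true = refl
same-comm true false = refl
same-comm false true = refl
same-comm false false = refl

same-notʳ : ∀ b b′ → same b (not b′) ≡ not (same b b′)
same-notʳ true b′ = refl
same-notʳ false b′ = refl

same-refl : ∀ b → same b b ≡ true
same-refl true = refl
same-refl false = refl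

module NilpotentGraph {X : Set} (_·_ : X → X → X) (_⁻¹ : X → X) (c : ℕ) where
  open NilpotentAction _·_ _⁻¹

  -- The graph is kept only as its multiplicities. The bound `c` on the length of the central series
  -- is shared by all these graphs, as passing to a quotient preserves it.
  record Weighted (n : ℕ) : Set where
    field
      action    : Action n
    open ActionProperties action public
    field
      nilpotent : ∀ x → Z c x
      μ         : Fin n → Fin n → ℕ
      μ-sym     : ∀ u v → μ u v ≡ μ v u
      μ-irrefl  : ∀ u → μ u u ≡ 0
      invariant : ∀ x u v → μ (act x u) (act x v) ≡ μ u v
      degree≥4  : ∀ u → 4 ≤ Σℕ.sum (μ u)

  module _ {n : ℕ} (G : Weighted n) where
    open Weighted G

    Orbital : Fin n × Fin n → Fin n × Fin n → Set
    Orbital (u , v) (u′ , v′) = ∃[ x ] (act x u ≡ u′ × act x v ≡ v′)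

    -- No element swaps two vertices: an invariant orientation

    module NoSwap (orbital? : ∀ p p′ → Dec (Orbital p p′))
                  (no-swap : ∀ {u v} → u ≢ v → ¬ Orbital (u , v) (v , u)) where

      orbit-id : ∀ p → Orbital p p
      orbit-id (u , v) =
        -- The product of any element with its inverse acts as the identity; transitivity supplies
        -- such an element.
        let x , xu = transitive u u
        in x · (x ⁻¹) , trans (act-· x (x ⁻¹) u) (act-⁻¹ˡ x u) , trans (act-· x (x ⁻¹) v) (act-⁻¹ˡ x v)

      orbitals : Quotient (λ i j → Orbital (remQuot n i) (remQuot n j))
      orbitals = quotient _ (λ i j → orbital? (remQuot n i) (remQuot n j)) (λ i → orbit-id (remQuot n i))
        (λ (x , p , q) → x ⁻¹ , act-inverse x p , act-inverse x q)
        (λ (x , p , q) (y , p′ , q′) → x · y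
          , trans (act-· x y _) (trans (cong (act y) p) p′)
          , trans (act-· x y _) (trans (cong (act y) q) q′))
      open Quotient orbitals

      code : Fin n → Fin n → Fin size
      code u v = class (combine u v)

      code-invariant : ∀ x u v → code (act x u) (act x v) ≡ code u v
      code-invariant x u v = sym (sound (subst₂ Orbital (sym (Finₚ.remQuot-combine u v))
        (sym (Finₚ.remQuot-combine (act x u) (act x v))) (x , refl , refl)))

      code-injective : ∀ {u v} → u ≢ v → code u v ≢ code v u
      code-injective {u} {v} u≢v eq = no-swap u≢v
        (subst₂ Orbital (Finₚ.remQuot-combine u v) (Finₚ.remQuot-combine v u) (exact eq))

      mask : ℕ → ℤ₃ → ℤ₃
      mask 0 _ = 𝟎
      mask (suc _) t = t

      -- Adjacent pairs carry ±1, with the sign found by comparing the number of the orbital with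
      -- that of its inverse. The numbers differ by `no-swap`, and they are invariant under the
      -- group.
      F : Fin n → Fin n → ℤ₃
      F u v = mask (μ u v) (sgn (code u v) (code v u))

      F-antisym : ∀ u v → F v u ≡ ⊖ F u v
      F-antisym u v = trans (cong₂ mask (μ-sym v u) (sgn-antisym (code u v) (code v u))) (mask-⊖ (μ u v))
        where
        mask-⊖ : ∀ m {t} → mask m (⊖ t) ≡ ⊖ mask m t
        mask-⊖ 0 = refl
        mask-⊖ (suc _) = refl

      F-invariant : ∀ x u v → F (act x u) (act x v) ≡ F u v
      F-invariant x u v = cong₂ mask (invariant x u v) (cong₂ sgn (code-invariant x u v) (code-invariant x v u))

      F-attainable : ∀ u v → Attainable (μ u v) (F u v)
      F-attainable u v with μ u v in eq
      ... | 0 = refl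
      ... | 1 = sgn≢𝟎 (code-injective λ { refl → contradiction (trans (sym eq) (μ-irrefl u)) λ () })
      ... | suc (suc _) = tt

      -- Taken in the integers because `out≡0` cancels the factor `n`, which may be a multiple of 3.
      out : Fin n → ℤ
      out u = Σℤ.sum (toℤ ∘ F u)

      out-constant : ∀ u v → out u ≡ out v
      out-constant u v = let x , xu≡v = transitive u v in begin
        out u ≡⟨ Σℤ.sum-cong-≗ (λ w → cong toℤ (sym (F-invariant x u w))) ⟩
        Σℤ.sum (λ w → toℤ (F (act x u) (act x w))) ≡⟨ sym (Σℤ.sum-permute (toℤ ∘ F (act x u)) (perm x)) ⟩
        out (act x u) ≡⟨ cong out xu≡v ⟩
        out v ∎
        where open ≡-Reasoning

      out≡0 : ∀ u → out u ≡ + 0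
      out≡0 u = case ℤₚ.i*j≡0⇒i≡0∨j≡0 (+ n) n*out≡0 of λ
        { (inj₁ n≡0) → ⊥-elim (Finₚ.¬Fin0 (subst Fin (ℤₚ.+-injective n≡0) u)) ; (inj₂ eq) → eq }
        where
        n*out≡0 : + n ℤ.* out u ≡ + 0
        n*out≡0 = trans (sym (sumℤ-const n (out u))) (trans (Σℤ.sum-cong-≗ (λ v → out-constant u v))
          (sum-antisymmetric (λ v w → toℤ (F v w)) (λ v w → trans (cong toℤ (F-antisym v w)) (toℤ-⊖ (F v w)))))

      flow₃ : Flow₃ μ
      flow₃ = record { flow = F ; antisym = F-antisym ; attainable = F-attainable
                     ; balanced = λ u → sum-toℤ≡0⇒sum≡𝟎 (F u) (out≡0 u) }

    -- The blocks of a central involution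

    module CentralInvolution (z : X) (z-invol : Involution z) (z-comm : Commuting z) where

      ζ : Fin n → Fin n
      ζ = act z

      ζζ : ∀ v → ζ (ζ v) ≡ v
      ζζ = proj₂ z-invol

      -- The fixed points of a central element form an invariant set, and by transitivity one fixed
      -- point would make `z` act trivially.
      ζ-free : ∀ v → ζ v ≢ v
      ζ-free v ζv≡v = proj₁ z-invol λ u →
        let x , xv≡u = transitive v u
        in trans (cong ζ (sym xv≡u)) (trans (sym (z-comm x v)) (trans (cong (act x) ζv≡v) xv≡u))

      μ-ζ-constant : ∀ u v → μ u (ζ u) ≡ μ v (ζ v)
      μ-ζ-constant u v =
        let x , xu≡v = transitive u v
        in trans (sym (invariant x u (ζ u))) (trans (cong (μ (act x u)) (z-comm x u)) (cong (λ w → μ w (ζ w)) xu≡v))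

      μ-ζˡ : ∀ u v → μ (ζ u) v ≡ μ u (ζ v)
      μ-ζˡ u v = trans (sym (invariant z (ζ u) v)) (cong (λ w → μ w (ζ v)) (ζζ u))

      μ-ζ-sym : ∀ u v → μ u (ζ v) ≡ μ v (ζ u)
      μ-ζ-sym u v = trans (sym (μ-ζˡ u v)) (μ-sym (ζ u) v)

      _~_ : Fin n → Fin n → Set
      u ~ v = u ≡ v ⊎ u ≡ ζ v

      ~-trans : ∀ {u v w} → u ~ v → v ~ w → u ~ w
      ~-trans (inj₁ refl) p = p
      ~-trans (inj₂ p) (inj₁ refl) = inj₂ p
      ~-trans (inj₂ refl) (inj₂ refl) = inj₁ (ζζ _)

      blocks : Quotient _~_
      blocks = quotient _~_ (λ u v → (u ≟ v) ⊎-dec (u ≟ ζ v)) (λ _ → inj₁ refl)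
        (λ { (inj₁ p) → inj₁ (sym p) ; (inj₂ p) → inj₂ (trans (sym (ζζ _)) (cong ζ (sym p))) }) ~-trans

      open Quotient blocks public renaming (size to k; class to q; rep to r; class-rep to qr)

      q-ζ : ∀ v → q (ζ v) ≡ q v
      q-ζ v = sound (inj₂ refl)

      -- Block and side are coordinates of a vertex: `q` and `side` together invert `point`.
      point : Fin k → Bool → Fin n
      point j true = r j
      point j false = ζ (r j)

      side : Fin n → Bool
      side v = ⌊ v ≟ r (q v) ⌋

      q-point : ∀ j b → q (point j b) ≡ j
      q-point j true = qr j
      q-point j false = trans (q-ζ (r j)) (qr j)

      side-point : ∀ j b → side (point j b) ≡ b
      side-point j true with r j ≟ r (q (r j))
      ... | yes _ = refl
      ... | no ≢r = contradiction (cong r (sym (qr j))) ≢r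
      side-point j false with ζ (r j) ≟ r (q (ζ (r j)))
      ... | yes ≡r = contradiction (trans ≡r (cong r (q-point j false))) (ζ-free (r j))
      ... | no _ = refl

      fibre : ∀ v → v ≡ r (q v) ⊎ v ≡ ζ (r (q v))
      fibre v = exact (sym (qr (q v)))

      point-q-side : ∀ v → point (q v) (side v) ≡ v
      point-q-side v with v ≟ r (q v)
      ... | yes e = sym e
      ... | no ≢r with fibre v
      ...   | inj₁ e = contradiction e ≢r
      ...   | inj₂ e = sym e

      side-ζ : ∀ v → side (ζ v) ≡ not (side v)
      side-ζ v with side v | point-q-side v
      ... | true | e = trans (cong (side ∘ ζ) (sym e)) (side-point (q v) false)
      ... | false | e = trans (cong (side ∘ ζ) (sym e)) (trans (cong side (ζζ (r (q v)))) (side-point (q v) true))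

      -- The representatives together with the `ζ`-image of one of them are distinct vertices. The
      -- induction on the number of vertices rests on this decrease.
      k<n : Fin n → k < n
      k<n v₀ = Finₚ.injective⇒≤ {f = embed} embed-injective
        where
        embed : Fin (suc k) → Fin n
        embed zero = ζ (r (q v₀))
        embed (suc i) = r i
        missed : ∀ j i → ζ (r j) ≢ r i
        missed j i eq = ζ-free (r j) (trans eq (cong r (trans (sym (qr i)) (trans (sym (cong q eq)) (q-point j false)))))
        embed-injective : ∀ {i j} → embed i ≡ embed j → i ≡ j
        embed-injective {zero} {zero} _ = refl
        embed-injective {zero} {suc j} eq = contradiction eq (missed (q v₀) j)
        embed-injective {suc i} {zero} eq = contradiction (sym eq) (missed (q v₀) i)
        embed-injective {suc i} {suc j} eq = cong suc (trans (sym (qr i)) (trans (cong q eq) (qr j)))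

      -- Edges that keep the side become positive edges of the graph on the blocks, those that
      -- change it negative ones.
      α β : Fin k → Fin k → ℕ
      α i j = μ (r i) (r j)
      β i j = μ (r i) (ζ (r j))

      degree-blocks : ∀ i → Σℕ.sum (μ (r i)) ≡ Σℕ.sum (λ j → α i j + β i j)
      degree-blocks i = Σℕ.sum-two-point-fibres q r (ζ ∘ r) (λ j e → ζ-free (r j) (sym e)) qr
        (λ j → q-point j false) fibre (μ (r i))

      sum-blocks : ∀ f → Σ₃.sum f ≡ Σ₃.sum (λ j → f (r j) ⊕ f (ζ (r j)))
      sum-blocks = Σ₃.sum-two-point-fibres q r (ζ ∘ r) (λ j e → ζ-free (r j) (sym e)) qr
        (λ j → q-point j false) fibre

      -- No edge joins v to ζ v: lifting a flow from the quotient

      module Independent (μ-ζ≡0 : ∀ v → μ v (ζ v) ≡ 0) where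

        -- The multiplicity in the quotient. It counts the edges from one vertex `u` to the whole
        -- block of `v`, so valencies are preserved.
        M : Fin n → Fin n → ℕ
        M u v = μ u v + μ u (ζ v)

        M-ζʳ : ∀ u v → M u (ζ v) ≡ M u v
        M-ζʳ u v = trans (cong (λ w → μ u (ζ v) + μ u w) (ζζ v)) (ℕₚ.+-comm (μ u (ζ v)) (μ u v))

        M-ζˡ : ∀ u v → M (ζ u) v ≡ M u v
        M-ζˡ u v = trans (cong₂ _+_ (μ-ζˡ u v) (invariant z u v)) (ℕₚ.+-comm (μ u (ζ v)) (μ u v))

        M-class : ∀ u v → M (r (q u)) (r (q v)) ≡ M u v
        M-class u v = trans (left (r (q v))) (right v)
          where
          left : ∀ w → M (r (q u)) w ≡ M u w
          left w with fibre u
          ... | inj₁ e = cong (λ t → M t w) (sym e)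
          ... | inj₂ e = trans (sym (M-ζˡ (r (q u)) w)) (cong (λ t → M t w) (sym e))
          right : ∀ v → M u (r (q v)) ≡ M u v
          right v with fibre v
          ... | inj₁ e = cong (M u) (sym e)
          ... | inj₂ e = trans (sym (M-ζʳ u (r (q v)))) (cong (M u) (sym e))

        -- Since `z` is central, the block reached does not depend on the chosen point of the
        -- starting block.
        q-act : ∀ x v → q (act x (r (q v))) ≡ q (act x v)
        q-act x v with fibre v
        ... | inj₁ e = cong (q ∘ act x) (sym e)
        ... | inj₂ e = trans (sym (q-ζ _)) (cong q (trans (sym (z-comm x _)) (cong (act x) (sym e))))

        block-action : Action k
        block-action = record
          { act = λ x i → q (act x (r i))
          ; act-· = λ x y i → trans (cong q (act-· x y (r i))) (sym (q-act y (act x (r i))))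
          ; act-⁻¹ˡ = λ x i → trans (q-act (x ⁻¹) _) (trans (cong q (act-⁻¹ˡ x (r i))) (qr i))
          ; act-⁻¹ʳ = λ x i → trans (q-act x _) (trans (cong q (act-⁻¹ʳ x (r i))) (qr i))
          ; transitive = λ i j → let x , e = transitive (r i) (r j) in x , trans (cong q e) (qr j) }

        -- Commutators are formed in `X` for both actions, so only triviality has to be passed down.
        Z-blocks : ∀ i {x} → Z i x → ActionProperties.Z block-action i x
        Z-blocks zero triv i = trans (cong q (triv (r i))) (qr i)
        Z-blocks (suc i) x∈Z y = Z-blocks i (x∈Z y)

        block-graph : Weighted k
        block-graph = record
          { action = block-action
          ; nilpotent = λ x → Z-blocks c (nilpotent x)
          ; μ = λ i j → M (r i) (r j)
          ; μ-sym = λ i j → cong₂ _+_ (μ-sym (r i) (r j)) (μ-ζ-sym (r i) (r j))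
          ; μ-irrefl = λ i → cong₂ _+_ (μ-irrefl (r i)) (μ-ζ≡0 (r i))
          ; invariant = λ x i j → trans (M-class (act x (r i)) (act x (r j)))
              (cong₂ _+_ (invariant x _ _) (trans (cong (μ (act x (r i))) (sym (z-comm x (r j)))) (invariant x _ _)))
          ; degree≥4 = λ i → subst (4 ≤_) (degree-blocks i) (degree≥4 (r i)) }

        -- The part of t carried by the first of two bundles with m and m′ edges; e and ⊖ e
        -- are used when the two bundles have to cancel.
        share : ℕ → ℕ → ℤ₃ → ℤ₃ → ℤ₃
        share 0 _ t e = 𝟎
        share (suc _) 0 t e = t
        share (suc _) (suc _) 𝟎 e = e
        share (suc _) (suc _) 𝟏 e = 𝟐
        share (suc _) (suc _) 𝟐 e = 𝟏

        share-⊖ : ∀ m m′ t e → share m m′ (⊖ t) (⊖ e) ≡ ⊖ share m m′ t e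
        share-⊖ 0 _ t e = refl
        share-⊖ (suc _) 0 t e = refl
        share-⊖ (suc _) (suc _) 𝟎 e = refl
        share-⊖ (suc _) (suc _) 𝟏 e = refl
        share-⊖ (suc _) (suc _) 𝟐 e = refl

        share-attainable : ∀ m m′ t e → Attainable (m + m′) t → (1 ≤ m → e ≢ 𝟎) → Attainable m (share m m′ t e)
        share-attainable 0 _ t e _ _ = refl
        share-attainable (suc m) 0 t e att _ = subst (λ k → Attainable k t) (ℕₚ.+-identityʳ (suc m)) att
        share-attainable 1 (suc _) 𝟎 e _ e≢0 = e≢0 (s≤s z≤n)
        share-attainable 1 (suc _) 𝟏 e _ _ = λ ()
        share-attainable 1 (suc _) 𝟐 e _ _ = λ ()
        share-attainable (suc (suc _)) (suc _) t e _ _ = tt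

        share-sum : ∀ m m′ t e → Attainable (m + m′) t → share m m′ t e ⊕ share m′ m t (⊖ e) ≡ t
        share-sum 0 0 t e att = sym att
        share-sum 0 (suc _) t e _ = refl
        share-sum (suc _) 0 t e _ = ⊕-identityʳ t
        share-sum (suc _) (suc _) 𝟎 e _ = ⊕-inverseʳ e
        share-sum (suc _) (suc _) 𝟏 e _ = refl
        share-sum (suc _) (suc _) 𝟐 e _ = refl

        module _ (F′ : Flow₃ (λ i j → M (r i) (r j))) where
          open Flow₃ F′

          -- The amount by which the bundles from `u` to `v` and to `ζ v` cancel if the quotient
          -- flow vanishes there: antisymmetric, reversed when `v` is replaced by `ζ v`, and nonzero
          -- between different blocks.
          e : Fin n → Fin n → ℤ₃
          e u v = signed (same (side u) (side v)) (sgn (q u) (q v))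

          e-antisym : ∀ u v → e v u ≡ ⊖ e u v
          e-antisym u v = trans (cong₂ signed (same-comm (side v) (side u)) (sgn-antisym (q u) (q v)))
                                (signed-⊖ (same (side u) (side v)) _)

          e-ζ : ∀ u v → e u (ζ v) ≡ ⊖ e u v
          e-ζ u v = trans (cong₂ signed (trans (cong (same (side u)) (side-ζ v)) (same-notʳ (side u) (side v)))
                            (cong (sgn (q u)) (q-ζ v)))
                          (signed-not (same (side u) (side v)) _)

          F : Fin n → Fin n → ℤ₃
          F u v = share (μ u v) (μ u (ζ v)) (flow (q u) (q v)) (e u v)

          att : ∀ u v → Attainable (μ u v + μ u (ζ v)) (flow (q u) (q v))
          att u v = subst (λ m → Attainable m (flow (q u) (q v))) (M-class u v) (attainable (q u) (q v))

          edge⇒q≢ : ∀ u v → 1 ≤ μ u v → q u ≢ q v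
          edge⇒q≢ u v le eq with exact eq
          ... | inj₁ refl = contradiction (subst (1 ≤_) (μ-irrefl u) le) λ ()
          ... | inj₂ refl = contradiction (subst (1 ≤_) (trans (μ-sym (ζ v) v) (μ-ζ≡0 v)) le) λ ()

          pair-sum : ∀ u v → F u v ⊕ F u (ζ v) ≡ flow (q u) (q v)
          pair-sum u v = begin
            F u v ⊕ share (μ u (ζ v)) (μ u (ζ (ζ v))) (flow (q u) (q (ζ v))) (e u (ζ v))
              ≡⟨ cong (F u v ⊕_) (cong₂ (λ w t → share (μ u (ζ v)) (μ u w) t (e u (ζ v))) (ζζ v) (cong (flow (q u)) (q-ζ v))) ⟩
            F u v ⊕ share (μ u (ζ v)) (μ u v) (flow (q u) (q v)) (e u (ζ v))
              ≡⟨ cong (λ t → F u v ⊕ share (μ u (ζ v)) (μ u v) (flow (q u) (q v)) t) (e-ζ u v) ⟩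
            F u v ⊕ share (μ u (ζ v)) (μ u v) (flow (q u) (q v)) (⊖ e u v)
              ≡⟨ share-sum (μ u v) (μ u (ζ v)) (flow (q u) (q v)) (e u v) (att u v) ⟩
            flow (q u) (q v) ∎
            where open ≡-Reasoning

          lifted-flow : Flow₃ μ
          lifted-flow = record
            { flow = F
            ; antisym = λ u v → begin
                share (μ v u) (μ v (ζ u)) (flow (q v) (q u)) (e v u)
                  ≡⟨ cong₂ (λ m m′ → share m m′ (flow (q v) (q u)) (e v u)) (μ-sym v u) (μ-ζ-sym v u) ⟩
                share (μ u v) (μ u (ζ v)) (flow (q v) (q u)) (e v u)
                  ≡⟨ cong₂ (share (μ u v) (μ u (ζ v))) (antisym (q u) (q v)) (e-antisym u v) ⟩
                share (μ u v) (μ u (ζ v)) (⊖ flow (q u) (q v)) (⊖ e u v)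
                  ≡⟨ share-⊖ (μ u v) (μ u (ζ v)) _ _ ⟩
                ⊖ F u v ∎
            ; attainable = λ u v → share-attainable (μ u v) (μ u (ζ v)) _ _ (att u v)
                λ le → signed≢𝟎 (same (side u) (side v)) (sgn≢𝟎 (edge⇒q≢ u v le))
            ; balanced = λ u → begin
                Σ₃.sum (F u)                                ≡⟨ sum-blocks (F u) ⟩
                Σ₃.sum (λ j → F u (r j) ⊕ F u (ζ (r j)))    ≡⟨ Σ₃.sum-cong-≗ (λ j → trans (pair-sum u (r j)) (cong (flow (q u)) (qr j))) ⟩
                Σ₃.sum (flow (q u))                         ≡⟨ balanced (q u) ⟩
                𝟎 ∎ }
            where open ≡-Reasoning

      -- Edges join v to ζ v: a flow reversed by ζ and its correction

      module Attached (s : ℕ) (μ-ζ≡s : ∀ v → μ v (ζ v) ≡ suc s) where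

        -- The edges from `v` to `ζ v` would become loops on the blocks; they are left out here and
        -- kept for the correction.
        β′ : Fin k → Fin k → ℕ
        β′ i j = β i j Σℕ.when ⌊ ¬? (i ≟ j) ⌋

        β′-irrefl : ∀ i → β′ i i ≡ 0
        β′-irrefl i = Σℕ.when-no (¬? (i ≟ i)) (λ i≢i → i≢i refl)

        β′≡β : ∀ {i j} → i ≢ j → β′ i j ≡ β i j
        β′≡β {i} {j} i≢j = Σℕ.when-yes (¬? (i ≟ j)) i≢j

        β′-sym : ∀ i j → β′ i j ≡ β′ j i
        β′-sym i j = case i ≟ j of λ
          { (yes refl) → refl
          ; (no i≢j) → trans (β′≡β i≢j) (trans (μ-ζ-sym (r i) (r j)) (sym (β′≡β (i≢j ∘ sym)))) }

        open SignedGraph α β′ (λ i j → μ-sym (r i) (r j)) β′-sym (μ-irrefl ∘ r) β′-irrefl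

        block-degree : ∀ i → Σℕ.sum (λ j → α i j + β i j) ≡ suc s + Σℕ.sum (w i)
        block-degree i = begin
          Σℕ.sum (λ j → α i j + β i j)              ≡⟨ cong (_+ Σℕ.sum (λ j → α i j + β i j)) (sym (cong₂ _+_ (μ-irrefl (r i)) (β′-irrefl i))) ⟩
          w i i + Σℕ.sum (λ j → α i j + β i j)      ≡⟨ Σℕ.sum-update (w i) (λ j → α i j + β i j) i (λ j j≢i → cong (λ t → α i j + t) (sym (β′≡β (j≢i ∘ sym)))) ⟩
          α i i + β i i + Σℕ.sum (w i)              ≡⟨ cong (_+ Σℕ.sum (w i)) (cong₂ _+_ (μ-irrefl (r i)) (μ-ζ≡s (r i))) ⟩
          suc s + Σℕ.sum (w i) ∎
          where open ≡-Reasoning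

        initial : State
        initial i j = sgn i j Σ₃.when ⌊ 1 ℕ.≤? α i j ⌋ , 𝟏 Σ₃.when ⌊ 1 ℕ.≤? β′ i j ⌋

        when-attainable : ∀ m {t} → (1 ≤ m → t ≢ 𝟎) → Attainable m (t Σ₃.when ⌊ 1 ℕ.≤? m ⌋)
        when-attainable 0 _ = refl
        when-attainable 1 t≢0 = t≢0 (s≤s z≤n)
        when-attainable (suc (suc _)) _ = tt

        when-⊖ : ∀ b t → (⊖ t) Σ₃.when b ≡ ⊖ (t Σ₃.when b)
        when-⊖ true t = refl
        when-⊖ false t = refl

        initial-valid : Valid initial
        initial-valid = record
          { reversal = λ i j → cong₂ _,_
              (trans (cong₂ (λ t m → t Σ₃.when ⌊ 1 ℕ.≤? m ⌋) (sgn-antisym i j) (μ-sym (r j) (r i))) (when-⊖ ⌊ 1 ℕ.≤? α i j ⌋ (sgn i j)))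
              (cong (λ m → 𝟏 Σ₃.when ⌊ 1 ℕ.≤? m ⌋) (β′-sym j i))
          ; domain = λ i j →
              when-attainable (α i j) (λ le → sgn≢𝟎 λ { refl → contradiction (subst (1 ≤_) (μ-irrefl (r i)) le) λ () })
            , when-attainable (β′ i j) (λ _ ()) }

        -- `s` is one less than the number of edges from `u` to `ζ u`. A nonzero excess is demanded
        -- only when there is a single such edge, as this cannot carry 𝟎.
        module _ (S : State) (vS : Valid S) (excess-ok : ∀ i → s ≡ 0 → excess S i ≢ 𝟎) where

          part : Bool → ℤ₃ × ℤ₃ → ℤ₃
          part true = proj₁
          part false = proj₂

          S-diagonal : ∀ b i → part b (S i i) ≡ 𝟎
          S-diagonal true i = subst (λ m → Attainable m (proj₁ (S i i))) (μ-irrefl (r i)) (proj₁ (domain vS i i))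
          S-diagonal false i = subst (λ m → Attainable m (proj₂ (S i i))) (β′-irrefl i) (proj₂ (domain vS i i))

          -- The lift of the state in coordinates. Applying `ζ` to both vertices flips both sides,
          -- which keeps `same b b′` and reverses the sign: this is how the flow comes to be
          -- reversed by `ζ`.
          H : Fin k → Bool → Fin k → Bool → ℤ₃
          H i b j b′ = signed b (part (same b b′) (S i j))

          H-antisym : ∀ i b j b′ → H j b′ i b ≡ ⊖ H i b j b′
          H-antisym i b j b′ = trans (cong (λ t → signed b′ (part (same b′ b) t)) (reversal vS i j)) (flip b b′)
            where
            flip : ∀ b b′ → signed b′ (part (same b′ b) (rev (S i j))) ≡ ⊖ signed b (part (same b b′) (S i j))
            flip true true = refl
            flip true false = refl
            flip false true = sym (⊖-involutive _)
            flip false false = refl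

          H-sum : ∀ i b j → H i b j true ⊕ H i b j false ≡ signed b (κ (S i j))
          H-sum i true j = refl
          H-sum i false j = trans (⊕-comm (⊖ proj₂ (S i j)) (⊖ proj₁ (S i j))) (sym (⊖-distrib-⊕ (proj₁ (S i j)) (proj₂ (S i j))))

          G₀ : Fin n → Fin n → ℤ₃
          G₀ u v = H (q u) (side u) (q v) (side v)

          G₀-ζ : ∀ u → G₀ u (ζ u) ≡ 𝟎
          G₀-ζ u = trans (cong (λ j → H (q u) (side u) j (side (ζ u))) (q-ζ u)) (diagonal (side u) (side (ζ u)))
            where
            diagonal : ∀ b b′ → H (q u) b (q u) b′ ≡ 𝟎
            diagonal true b′ = S-diagonal (same true b′) (q u)
            diagonal false b′ = cong ⊖_ (S-diagonal (same false b′) (q u))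

          sum-signed : ∀ b (f : Fin k → ℤ₃) → Σ₃.sum (λ j → signed b (f j)) ≡ signed b (Σ₃.sum f)
          sum-signed true f = refl
          sum-signed false f = sum-⊖ f

          G₀-sum : ∀ u → Σ₃.sum (G₀ u) ≡ signed (side u) (excess S (q u))
          G₀-sum u = begin
            Σ₃.sum (G₀ u)
              ≡⟨ sum-blocks (G₀ u) ⟩
            Σ₃.sum (λ j → G₀ u (point j true) ⊕ G₀ u (point j false))
              ≡⟨ Σ₃.sum-cong-≗ (λ j → cong₂ _⊕_ (at j true) (at j false)) ⟩
            Σ₃.sum (λ j → H (q u) (side u) j true ⊕ H (q u) (side u) j false)
              ≡⟨ Σ₃.sum-cong-≗ (H-sum (q u) (side u)) ⟩
            Σ₃.sum (λ j → signed (side u) (κ (S (q u) j)))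
              ≡⟨ sum-signed (side u) (λ j → κ (S (q u) j)) ⟩
            signed (side u) (excess S (q u)) ∎
            where
            open ≡-Reasoning
            at : ∀ j b → G₀ u (point j b) ≡ H (q u) (side u) j b
            at j b = cong₂ (H (q u) (side u)) (q-point j b) (side-point j b)

          correction : Fin n → ℤ₃
          correction u = ⊖ signed (side u) (excess S (q u))

          correction-ζ : ∀ u → correction (ζ u) ≡ ⊖ correction u
          correction-ζ u = cong ⊖_ (trans (cong₂ signed (side-ζ u) (cong (excess S) (q-ζ u))) (signed-not (side u) _))

          F : Fin n → Fin n → ℤ₃
          F u v = if ⌊ v ≟ ζ u ⌋ then correction u else G₀ u v

          F-antisym : ∀ u v → F v u ≡ ⊖ F u v
          F-antisym u v with v ≟ ζ u | u ≟ ζ v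
          ... | yes refl | yes _ = correction-ζ u
          ... | yes refl | no u≢ = contradiction (sym (ζζ u)) u≢
          ... | no v≢ | yes refl = contradiction (sym (ζζ v)) v≢
          ... | no _ | no _ = H-antisym (q u) (side u) (q v) (side v)

          weight : Bool → Fin k → Fin k → ℕ
          weight true = α
          weight false = β

          μ-point : ∀ i b j b′ → μ (point i b) (point j b′) ≡ weight (same b b′) i j
          μ-point i true j true = refl
          μ-point i true j false = refl
          μ-point i false j true = μ-ζˡ (r i) (r j)
          μ-point i false j false = invariant z (r i) (r j)

          signed-attainable : ∀ b m {t} → Attainable m t → Attainable m (signed b t)
          signed-attainable true m att = att
          signed-attainable false m att = Attainable-⊖ m att

          part-attainable : ∀ b i j → (b ≡ false → i ≢ j) → Attainable (weight b i j) (part b (S i j))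
          part-attainable true i j _ = proj₁ (domain vS i j)
          part-attainable false i j i≢j = subst (λ m → Attainable m (proj₂ (S i j))) (β′≡β (i≢j refl)) (proj₂ (domain vS i j))

          F-attainable : ∀ u v → Attainable (μ u v) (F u v)
          F-attainable u v with v ≟ ζ u
          ... | yes refl = subst (λ m → Attainable m (correction u)) (sym (μ-ζ≡s u)) (correct s refl)
            where
            correct : ∀ s′ → s ≡ s′ → Attainable (suc s′) (correction u)
            correct zero s≡0 = ⊖≢𝟎 (signed≢𝟎 (side u) (excess-ok (q u) s≡0))
            correct (suc _) _ = tt
          ... | no v≢ζu = subst (λ m → Attainable m (G₀ u v))
              (trans (sym (μ-point (q u) (side u) (q v) (side v))) (cong₂ μ (point-q-side u) (point-q-side v)))
              (signed-attainable (side u) (weight (same (side u) (side v)) (q u) (q v))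
                (part-attainable (same (side u) (side v)) (q u) (q v) different))
            where
            different : same (side u) (side v) ≡ false → q u ≢ q v
            different sf qu≡qv with exact (sym qu≡qv)
            ... | inj₁ refl = contradiction (trans (sym (same-refl (side u))) sf) λ ()
            ... | inj₂ v≡ζu = v≢ζu v≡ζu

          F-balanced : ∀ u → Σ₃.sum (F u) ≡ 𝟎
          F-balanced u = begin
            Σ₃.sum (F u)                       ≡⟨ cong (_⊕ Σ₃.sum (F u)) (sym (G₀-ζ u)) ⟩
            G₀ u (ζ u) ⊕ Σ₃.sum (F u)          ≡⟨ Σ₃.sum-update (G₀ u) (F u) (ζ u) F≡G₀ ⟩
            F u (ζ u) ⊕ Σ₃.sum (G₀ u)          ≡⟨ cong₂ _⊕_ F-ζ (G₀-sum u) ⟩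
            correction u ⊕ signed (side u) (excess S (q u)) ≡⟨ ⊕-inverseˡ (signed (side u) (excess S (q u))) ⟩
            𝟎 ∎
            where
            open ≡-Reasoning
            F≡G₀ : ∀ v → v ≢ ζ u → F u v ≡ G₀ u v
            F≡G₀ v v≢ with v ≟ ζ u
            ... | yes e = contradiction e v≢
            ... | no _ = refl
            F-ζ : F u (ζ u) ≡ correction u
            F-ζ with ζ u ≟ ζ u
            ... | yes _ = refl
            ... | no ≢ = contradiction refl ≢

          flow-from-state : Flow₃ μ
          flow-from-state = record { flow = F ; antisym = F-antisym ; attainable = F-attainable ; balanced = F-balanced }

        attached-flow : Flow₃ μ
        attached-flow = case s ℕ.≟ 0 of λ
          -- The single edge to `ζ v` uses up one of at least four, which leaves degree at least
          -- three in the signed graph.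
          { (yes s≡0) →
              let S , vS , good = nowhere-zero-excess (λ i → ℕ.s≤s⁻¹ (subst (4 ≤_)
                    (trans (degree-blocks i) (trans (block-degree i) (cong (λ t → suc t + Σℕ.sum (w i)) s≡0))) (degree≥4 (r i))))
                    initial initial-valid
              in flow-from-state S vS (λ i _ → good i)
          ; (no s≢0) → flow-from-state initial initial-valid (λ _ s≡0 → contradiction s≡0 s≢0) }

  -- Induction on the number of vertices. Whether two pairs lie in one orbital is decided under a
  -- double negation, for all of the finitely many pairs at once.
  flow-mod-3 : ∀ {n} (G : Weighted n) → ¬ ¬ Flow₃ (Weighted.μ G)
  flow-mod-3 {n} G = go (<-wellFounded n) G
    where
    go : ∀ {n} → Acc _<_ n → (G : Weighted n) → ¬ ¬ Flow₃ (Weighted.μ G)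
    go {n} (acc smaller) G =
      ¬¬-all (λ i → ¬¬-all (λ j → ¬¬-excluded-middle {A = Orbital G (remQuot n i) (remQuot n j)})) >>= λ dec →
      cases (λ (u , v) (u′ , v′) → subst₂ (λ p p′ → Dec (Orbital G p p′))
        (Finₚ.remQuot-combine u v) (Finₚ.remQuot-combine u′ v′) (dec (combine u v) (combine u′ v′)))
      where
      open Weighted G
      cases : (∀ p p′ → Dec (Orbital G p p′)) → ¬ ¬ Flow₃ μ
      cases orbital? with Finₚ.any? (λ u → Finₚ.any? (λ v → ¬? (u ≟ v) ×-dec orbital? (u , v) (v , u)))
      ... | no none = pure (NoSwap.flow₃ G orbital? (λ {u} {v} u≢v sw → none (u , v , u≢v , sw)))
      ... | yes (u , v , u≢v , x , xu , xv) = swap⇒central-involution nilpotent x u≢v xu xv >>= central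
        where
        central : ∃[ z ] (Involution z × Commuting z) → ¬ ¬ Flow₃ μ
        central (z , z-invol , z-comm) with μ u (act z u) in eq
        ... | suc s = pure (CI.Attached.attached-flow s (λ v → trans (CI.μ-ζ-constant v u) eq))
          where module CI = CentralInvolution G z z-invol z-comm
        ... | 0 = go (smaller (CI.k<n u)) (Ind.block-graph) >>= λ F → pure (Ind.lifted-flow F)
          where
          module CI = CentralInvolution G z z-invol z-comm
          module Ind = CI.Independent (λ v → trans (CI.μ-ζ-constant v u) eq)

-- Integer flows

-- Used twice: with `x` equal to 3 to push value along an arc, and with the value of one edge to
-- split that edge off.
module Transfer {n : ℕ} (g : Fin n → Fin n → ℤ) (anti : ∀ u v → g v u ≡ ℤ.- g u v)
                (a b : Fin n) (a≢b : a ≢ b) (x : ℤ) where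

  g′ : Fin n → Fin n → ℤ
  g′ u v with (u ≟ a) ×-dec (v ≟ b) | (u ≟ b) ×-dec (v ≟ a)
  ... | yes _ | _     = g u v ℤ.- x
  ... | no _  | yes _ = g u v ℤ.+ x
  ... | no _  | no _  = g u v

  g′-ab : g′ a b ≡ g a b ℤ.- x
  g′-ab with (a ≟ a) ×-dec (b ≟ b)
  ... | yes _ = refl
  ... | no ¬p = contradiction (refl , refl) ¬p

  g′-ba : g′ b a ≡ g b a ℤ.+ x
  g′-ba with (b ≟ a) ×-dec (a ≟ b) | (b ≟ b) ×-dec (a ≟ a)
  ... | yes (b≡a , _) | _ = contradiction (sym b≡a) a≢b
  ... | no _ | yes _ = refl
  ... | no _ | no ¬p = contradiction (refl , refl) ¬p

  g′-old : ∀ u v → ¬ (u ≡ a × v ≡ b) → ¬ (u ≡ b × v ≡ a) → g′ u v ≡ g u v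
  g′-old u v ¬ab ¬ba with (u ≟ a) ×-dec (v ≟ b) | (u ≟ b) ×-dec (v ≟ a)
  ... | yes p | _ = contradiction p ¬ab
  ... | no _ | yes p = contradiction p ¬ba
  ... | no _ | no _ = refl

  g′-cases : (P : Fin n → Fin n → ℤ → Set) → P a b (g a b ℤ.- x) → P b a (g b a ℤ.+ x) →
    (∀ u v → ¬ (u ≡ a × v ≡ b) → ¬ (u ≡ b × v ≡ a) → P u v (g u v)) → ∀ u v → P u v (g′ u v)
  g′-cases P pab pba pold u v with (u ≟ a) ×-dec (v ≟ b) | (u ≟ b) ×-dec (v ≟ a)
  ... | yes (refl , refl) | _ = pab
  ... | no _ | yes (refl , refl) = pba
  ... | no ¬p | no ¬q = pold u v ¬p ¬q

  g′-antisym : ∀ u v → g′ v u ≡ ℤ.- g′ u v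
  g′-antisym = g′-cases (λ u v y → g′ v u ≡ ℤ.- y)
    (trans g′-ba (trans (cong (ℤ._+ x) (anti a b)) (negate (g a b) x)))
    (trans g′-ab (trans (cong (λ y → y ℤ.- x) (anti b a)) (negate′ (g b a) x)))
    (λ u v ¬p ¬q → trans (g′-old v u (λ (p , q) → ¬q (q , p)) (λ (p , q) → ¬p (q , p))) (anti u v))
    where
    negate : ∀ y x → ℤ.- y ℤ.+ x ≡ ℤ.- (y ℤ.- x)
    negate = solve-∀
    negate′ : ∀ y x → ℤ.- y ℤ.- x ≡ ℤ.- (y ℤ.+ x)
    negate′ = solve-∀

  g′-sum : ∀ v → Σℤ.sum (g′ v) ℤ.+ x Σℤ.when ⌊ a ≟ v ⌋ ≡ Σℤ.sum (g v) ℤ.+ x Σℤ.when ⌊ b ≟ v ⌋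
  g′-sum v with a ≟ v | b ≟ v
  ... | yes refl | yes refl = contradiction refl a≢b
  ... | yes refl | no _ = trans (cancel (g a b) (Σℤ.sum (g a)) (Σℤ.sum (g′ a)) x (subst (λ y → g a b ℤ.+ Σℤ.sum (g′ a) ≡ y ℤ.+ Σℤ.sum (g a)) g′-ab
      (Σℤ.sum-update (g a) (g′ a) b (λ w w≢b → g′-old a w (w≢b ∘ proj₂) (a≢b ∘ proj₁)))))
      (sym (ℤₚ.+-identityʳ (Σℤ.sum (g a))))
    where
    cancel : ∀ p s s′ x → p ℤ.+ s′ ≡ p ℤ.- x ℤ.+ s → s′ ℤ.+ x ≡ s
    cancel p s s′ x eq = trans (ring₁ p s′ x) (trans (cong (λ y → y ℤ.- p ℤ.+ x) eq) (ring₂ p s x))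
      where
      ring₁ : ∀ p s′ x → s′ ℤ.+ x ≡ p ℤ.+ s′ ℤ.- p ℤ.+ x
      ring₁ = solve-∀
      ring₂ : ∀ p s x → p ℤ.- x ℤ.+ s ℤ.- p ℤ.+ x ≡ s
      ring₂ = solve-∀
  ... | no _ | yes refl = trans (ℤₚ.+-identityʳ (Σℤ.sum (g′ b))) (cancel (g b a) (Σℤ.sum (g b)) (Σℤ.sum (g′ b)) x (subst (λ y → g b a ℤ.+ Σℤ.sum (g′ b) ≡ y ℤ.+ Σℤ.sum (g b)) g′-ba
      (Σℤ.sum-update (g b) (g′ b) a (λ w w≢a → g′-old b w (a≢b ∘ sym ∘ proj₁) (w≢a ∘ proj₂)))))
    where
    cancel : ∀ p s s′ x → p ℤ.+ s′ ≡ p ℤ.+ x ℤ.+ s → s′ ≡ s ℤ.+ x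
    cancel p s s′ x eq = trans (ring₁ p s′) (trans (cong (λ y → y ℤ.- p) eq) (ring₂ p s x))
      where
      ring₁ : ∀ p s′ → s′ ≡ p ℤ.+ s′ ℤ.- p
      ring₁ = solve-∀
      ring₂ : ∀ p s x → p ℤ.+ x ℤ.+ s ℤ.- p ≡ s ℤ.+ x
      ring₂ = solve-∀
  ... | no a≢v | no b≢v = cong (ℤ._+ + 0) (Σℤ.sum-cong-≗ λ w →
      g′-old v w (a≢v ∘ sym ∘ proj₁) (b≢v ∘ sym ∘ proj₁))

sumℤ-mono : ∀ {n} (f g : Fin n → ℤ) → (∀ i → f i ℤ.≤ g i) → Σℤ.sum f ℤ.≤ Σℤ.sum g
sumℤ-mono {zero} f g f≤g = ℤₚ.≤-refl
sumℤ-mono {suc n} f g f≤g = ℤₚ.+-mono-≤ (f≤g zero) (sumℤ-mono (f ∘ suc) (g ∘ suc) (f≤g ∘ suc))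

term≤sumℤ : ∀ {n} (f : Fin n → ℤ) → (∀ i → + 0 ℤ.≤ f i) → ∀ a → f a ℤ.≤ Σℤ.sum f
term≤sumℤ f f≥0 a = subst (ℤ._≤ Σℤ.sum f) (Σℤ.sum-when f a) (sumℤ-mono _ f below)
  where
  below : ∀ i → f i Σℤ.when ⌊ i ≟ a ⌋ ℤ.≤ f i
  below i with i ≟ a
  ... | yes _ = ℤₚ.≤-refl
  ... | no _ = f≥0 i

sumℤ-*ˡ : ∀ {n} c (f : Fin n → ℤ) → Σℤ.sum (λ i → c ℤ.* f i) ≡ c ℤ.* Σℤ.sum f
sumℤ-*ˡ {zero} c f = sym (ℤₚ.*-zeroʳ c)
sumℤ-*ˡ {suc n} c f = trans (cong (λ y → c ℤ.* f zero ℤ.+ y) (sumℤ-*ˡ c (f ∘ suc))) (sym (ℤₚ.*-distribˡ-+ c (f zero) _))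

Positive Negative : ℤ → Set
Positive (+ suc _) = ⊤
Positive _ = ⊥
Negative -[1+ _ ] = ⊤
Negative _ = ⊥

positive? : ∀ x → Dec (Positive x)
positive? (+ zero) = no λ ()
positive? (+ suc _) = yes tt
positive? -[1+ _ ] = no λ ()

negative? : ∀ x → Dec (Negative x)
negative? (+ _) = no λ ()
negative? -[1+ _ ] = yes tt

¬positive⇒≤0 : ∀ {x} → ¬ Positive x → x ℤ.≤ + 0
¬positive⇒≤0 {+ zero} _ = ℤₚ.≤-refl
¬positive⇒≤0 {+ suc _} ¬p = contradiction tt ¬p
¬positive⇒≤0 { -[1+ _ ]} _ = ℤ.-≤+

¬negative⇒≥0 : ∀ {x} → ¬ Negative x → + 0 ℤ.≤ x
¬negative⇒≥0 {+ _} _ = ℤ.+≤+ z≤n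
¬negative⇒≥0 { -[1+ _ ]} ¬p = contradiction tt ¬p

positive-neg : ∀ {x} → Positive x → ¬ Positive (ℤ.- x)
positive-neg {+ suc _} _ ()

-- The representatives of absolute value at most 2, the bound that a 3-flow has to obey; for 𝟎 this
-- leaves only 0.
data Represents : ℤ₃ → ℤ → Set where
  zero  : Represents 𝟎 (+ 0)
  one   : Represents 𝟏 (+ 1)
  one′  : Represents 𝟏 -[1+ 1 ]
  two   : Represents 𝟐 (+ 2)
  two′  : Represents 𝟐 -[1+ 0 ]

represents-toℤ : ∀ t → Represents t (toℤ t)
represents-toℤ 𝟎 = zero
represents-toℤ 𝟏 = one
represents-toℤ 𝟐 = two′

represents-neg : ∀ {t x} → Represents t x → Represents (⊖ t) (ℤ.- x)
represents-neg zero = zero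
represents-neg one = two′
represents-neg one′ = two
represents-neg two = one′
represents-neg two′ = one

-- The reason why augmenting paths follow positive values: exactly these can be lowered by 3 without
-- breaking the bound.
represents-shift : ∀ {t x} → Represents t x → Positive x → Represents t (x ℤ.- + 3)
represents-shift one _ = one′
represents-shift two _ = two′

pos : ℤ → ℕ
pos (+ n) = n
pos -[1+ _ ] = 0

-- Tutte's augmentation along directed paths

module Tutte {n : ℕ} (flow : Fin n → Fin n → ℤ₃) (flow-antisym : ∀ u v → flow v u ≡ ⊖ flow u v) where

  record State : Set where
    field
      value      : Fin n → Fin n → ℤ
      antisym    : ∀ u v → value v u ≡ ℤ.- value u v
      represents : ∀ u v → Represents (flow u v) (value u v)
      surplus    : Fin n → ℤ
      row-sum    : ∀ u → Σℤ.sum (value u) ≡ + 3 ℤ.* surplus u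

  open State

  total : State → ℕ
  total s = Σℕ.sum (pos ∘ surplus s)

  irreflexive : ∀ s {u v} → Positive (value s u v) → u ≢ v
  irreflexive s {u} p refl = positive-neg p (subst Positive (antisym s u u) p)

  data Path (s : State) : Fin n → Fin n → ℕ → Set where
    []  : ∀ {v} → Path s v v 0
    _∷_ : ∀ {v u w k} → Positive (value s v u) → Path s u w k → Path s v w (suc k)

  module Push (s : State) {v u : Fin n} (p : Positive (value s v u)) where
    v≢u : v ≢ u
    v≢u = irreflexive s p

    open Transfer (value s) (antisym s) v u v≢u (+ 3)

    ⟦_≟_⟧ : Fin n → Fin n → ℤ
    ⟦ a ≟ b ⟧ = (+ 1) Σℤ.when ⌊ a ≟ b ⌋

    pushed : State
    pushed = record
      { value = g′
      ; antisym = g′-antisym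
      ; represents = g′-cases (λ a b y → Represents (flow a b) y)
          (represents-shift (represents s v u) p)
          (subst₂ Represents (sym (flow-antisym v u)) (shift-neg (value s v u) (antisym s v u))
            (represents-neg (represents-shift (represents s v u) p)))
          (λ a b _ _ → represents s a b)
      ; surplus = λ y → surplus s y ℤ.+ ⟦ u ≟ y ⟧ ℤ.- ⟦ v ≟ y ⟧
      ; row-sum = λ y → trans (isolate _ _) (trans
          (cong (λ z → z ℤ.- (+ 3) Σℤ.when ⌊ v ≟ y ⌋) (trans (g′-sum y) (cong (ℤ._+ (+ 3) Σℤ.when ⌊ u ≟ y ⌋) (row-sum s y))))
          (trans (cong₂ (λ c d → + 3 ℤ.* surplus s y ℤ.+ c ℤ.- d) (triple ⌊ u ≟ y ⌋) (triple ⌊ v ≟ y ⌋))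
            (factor (surplus s y) ⟦ u ≟ y ⟧ ⟦ v ≟ y ⟧))) }
      where
      shift-neg : ∀ x {y} → y ≡ ℤ.- x → ℤ.- (x ℤ.- + 3) ≡ y ℤ.+ + 3
      shift-neg x refl = ring x
        where
        ring : ∀ x → ℤ.- (x ℤ.- + 3) ≡ ℤ.- x ℤ.+ + 3
        ring = solve-∀
      isolate : ∀ a b → a ≡ a ℤ.+ b ℤ.- b
      isolate = solve-∀
      triple : ∀ b → (+ 3) Σℤ.when b ≡ + 3 ℤ.* ((+ 1) Σℤ.when b)
      triple true = refl
      triple false = refl
      factor : ∀ t c d → + 3 ℤ.* t ℤ.+ + 3 ℤ.* c ℤ.- + 3 ℤ.* d ≡ + 3 ℤ.* (t ℤ.+ c ℤ.- d)
      factor = solve-∀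

    -- A path through the pushed arc contains a shorter path from its tail.
    shortcut : ∀ {x w k} → Path s x w k → Path pushed x w k ⊎ ∃[ k′ ] (k′ ≤ k × Path s v w k′)
    shortcut [] = inj₁ []
    shortcut {x} (_∷_ {u = y} {k = k} q path) with shortcut path | (x ≟ v) ×-dec (y ≟ u)
    ... | _ | yes (refl , _) = inj₂ (suc k , ℕₚ.≤-refl , q ∷ path)
    ... | inj₂ (k′ , k′≤k , path′) | _ = inj₂ (k′ , ℕₚ.m≤n⇒m≤1+n k′≤k , path′)
    ... | inj₁ path′ | no ¬vu = inj₁ (subst Positive (sym (g′-old x y ¬vu
          λ { (refl , refl) → positive-neg p (subst Positive (antisym s v u) q) })) q ∷ path′)

    -- A unit of surplus leaves `v`, where it was counted. At `u` it counts again unless it fills a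
    -- deficit. The equation is additive to avoid subtraction in `ℕ`.
    total-pushed : Positive (surplus s v) →
      total pushed ℕ.+ 1 ≡ total s ℕ.+ (if ⌊ negative? (surplus s u) ⌋ then 0 else 1)
    total-pushed t>0 = begin
      total pushed ℕ.+ 1
        ≡⟨ cong (total pushed ℕ.+_) (sym (Σℕ.sum-when′ (λ _ → 1) v)) ⟩
      total pushed ℕ.+ Σℕ.sum (λ y → 1 Σℕ.when ⌊ v ≟ y ⌋)
        ≡⟨ sym (Σℕ.∑-distrib-+ (pos ∘ surplus pushed) (λ y → 1 Σℕ.when ⌊ v ≟ y ⌋)) ⟩
      Σℕ.sum (λ y → pos (surplus pushed y) ℕ.+ 1 Σℕ.when ⌊ v ≟ y ⌋)
        ≡⟨ Σℕ.sum-cong-≗ pointwise ⟩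
      Σℕ.sum (λ y → pos (surplus s y) ℕ.+ ε Σℕ.when ⌊ u ≟ y ⌋)
        ≡⟨ Σℕ.∑-distrib-+ (pos ∘ surplus s) (λ y → ε Σℕ.when ⌊ u ≟ y ⌋) ⟩
      total s ℕ.+ Σℕ.sum (λ y → ε Σℕ.when ⌊ u ≟ y ⌋)
        ≡⟨ cong (total s ℕ.+_) (Σℕ.sum-when′ (λ _ → ε) u) ⟩
      total s ℕ.+ ε ∎
      where
      open ≡-Reasoning
      ε : ℕ
      ε = if ⌊ negative? (surplus s u) ⌋ then 0 else 1
      lower : ∀ t → Positive t → pos (t ℤ.+ + 0 ℤ.- + 1) ℕ.+ 1 ≡ pos t ℕ.+ 0
      lower (+ suc m) _ = trans (cong (λ y → pos (y ℤ.- + 1) ℕ.+ 1) (ℤₚ.+-identityʳ (+ suc m)))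
                            (trans (ℕₚ.+-comm m 1) (sym (ℕₚ.+-identityʳ (suc m))))
      raise : ∀ t → pos (t ℤ.+ + 1 ℤ.- + 0) ℕ.+ 0 ≡ pos t ℕ.+ (if ⌊ negative? t ⌋ then 0 else 1)
      raise (+ m) = trans (ℕₚ.+-identityʳ _) (cong pos (ℤₚ.+-identityʳ (+ (m ℕ.+ 1))))
      raise -[1+ zero ] = refl
      raise -[1+ suc m ] = refl
      pointwise : ∀ y → pos (surplus pushed y) ℕ.+ 1 Σℕ.when ⌊ v ≟ y ⌋ ≡ pos (surplus s y) ℕ.+ ε Σℕ.when ⌊ u ≟ y ⌋
      pointwise y with v ≟ y | u ≟ y
      ... | yes refl | yes refl = contradiction refl v≢u
      ... | yes refl | no _ = lower (surplus s v) t>0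
      ... | no _ | yes refl = raise (surplus s u)
      ... | no _ | no _ = cong (λ x → pos x ℕ.+ 0) (unchanged (surplus s y))
        where
        unchanged : ∀ t → t ℤ.+ + 0 ℤ.- + 0 ≡ t
        unchanged = solve-∀

    surplus-head : ¬ Negative (surplus s u) → Positive (surplus pushed u)
    surplus-head ¬neg with v ≟ u | u ≟ u
    ... | yes e | _ = contradiction e v≢u
    ... | no _ | no ≢ = contradiction refl ≢
    ... | no _ | yes _ = raise (surplus s u) ¬neg
      where
      raise : ∀ t → ¬ Negative t → Positive (t ℤ.+ + 1 ℤ.- + 0)
      raise (+ m) _ = subst Positive (sym (ℤₚ.+-identityʳ (+ (m ℕ.+ 1)))) (subst (Positive ∘ +_) (ℕₚ.+-comm 1 m) tt)
      raise -[1+ m ] ¬neg = contradiction tt ¬neg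

    surplus-other : ∀ w → v ≢ w → u ≢ w → surplus pushed w ≡ surplus s w
    surplus-other w v≢w u≢w with v ≟ w | u ≟ w
    ... | yes e | _ = contradiction e v≢w
    ... | no _ | yes e = contradiction e u≢w
    ... | no _ | no _ = unchanged (surplus s w)
      where
      unchanged : ∀ t → t ℤ.+ + 0 ℤ.- + 0 ≡ t
      unchanged = solve-∀

  positive⇒¬negative : ∀ {x} → Positive x → ¬ Negative x
  positive⇒¬negative {+ suc _} _ ()

  -- One unit of surplus is carried along the path. If the next vertex has a deficit, the total has
  -- dropped; otherwise that vertex now has positive surplus and the walk goes on from it in the new
  -- state. A path that would reuse the reversed arc is first replaced by a shorter one.
  augment : ∀ s {v w k} → Acc _<_ k → Path s v w k → Positive (surplus s v) → Negative (surplus s w) →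
            ∃[ s′ ] total s′ < total s
  augment s _ [] t>0 t<0 = contradiction t<0 (positive⇒¬negative t>0)
  augment s {v} {w} (acc smaller) (_∷_ {u = u} p path) t>0 t<0 with Push.shortcut s p path
  ... | inj₂ (k′ , k′≤k , path′) = augment s (smaller (s≤s k′≤k)) path′ t>0 t<0
  ... | inj₁ path′ with negative? (surplus s u) | Push.total-pushed s p t>0
  ...   | yes _ | eq = pushed , ℕₚ.≤-reflexive (trans (ℕₚ.+-comm 1 (total pushed)) (trans eq (ℕₚ.+-identityʳ (total s))))
    where open Push s p
  ...   | no ¬neg | eq =
      let s′ , lt = augment pushed (smaller ℕₚ.≤-refl) path′ (surplus-head ¬neg)
            (subst Negative (sym (surplus-other w (λ { refl → positive⇒¬negative t>0 t<0 }) (λ { refl → ¬neg t<0 }))) t<0)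
      in s′ , ℕₚ.≤-trans lt (ℕₚ.≤-reflexive (ℕₚ.+-cancelʳ-≡ 1 (total pushed) (total s) eq))
    where open Push s p

  snoc : ∀ {s v u w k} → Path s v u k → Positive (value s u w) → Path s v w (suc k)
  snoc [] q = q ∷ []
  snoc (p ∷ path) q = p ∷ snoc path q

  -- No value leaves the set of vertices reachable from v, so its surplus cannot be positive.
  deficit-reachable : ∀ s {v} → Positive (surplus s v) → (∀ w → Dec (∃[ k ] Path s v w k)) →
    ∃[ w ] (Negative (surplus s w) × ∃[ k ] Path s v w k)
  deficit-reachable s {v} t>0 reach? with Finₚ.any? (λ w → negative? (surplus s w) ×-dec reach? w)
  ... | yes found = found
  ... | no none = contradiction surplus≤0 (ℤₚ.<⇒≱ (positive⇒>0 t>0))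
    where
    positive⇒>0 : ∀ {x} → Positive x → + 0 ℤ.< x
    positive⇒>0 {+ suc _} _ = ℤ.+<+ (s≤s z≤n)
    R : Fin n → Bool
    R w = ⌊ reach? w ⌋
    -- Values inside the reachable set cancel in pairs and those leaving it are at most 0, so its
    -- surpluses have a sum of at most 0, although none of them is negative.
    inner outer : Fin n → Fin n → ℤ
    inner u w = (value s u w Σℤ.when R w) Σℤ.when R u
    outer u w = (value s u w Σℤ.when not (R w)) Σℤ.when R u
    inner-antisym : ∀ u w → inner w u ≡ ℤ.- inner u w
    inner-antisym u w with R u | R w
    ... | true | true = antisym s u w
    ... | true | false = refl
    ... | false | true = refl
    ... | false | false = refl
    split : ∀ u w → value s u w Σℤ.when R u ≡ inner u w ℤ.+ outer u w
    split u w with R u | R w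
    ... | true | true = sym (ℤₚ.+-identityʳ _)
    ... | true | false = sym (ℤₚ.+-identityˡ _)
    ... | false | _ = refl
    outer≤0 : ∀ u w → outer u w ℤ.≤ + 0
    outer≤0 u w with reach? u | reach? w
    ... | no _ | _ = ℤₚ.≤-refl
    ... | yes _ | yes _ = ℤₚ.≤-refl
    ... | yes (k , path) | no ¬reach = ¬positive⇒≤0 λ q → ¬reach (suc k , snoc path q)
    sum-when-row : ∀ u → Σℤ.sum (λ w → value s u w Σℤ.when R u) ≡ + 3 ℤ.* (surplus s u Σℤ.when R u)
    sum-when-row u with R u
    ... | true = row-sum s u
    ... | false = Σℤ.sum-zero (λ (_ : Fin n) → + 0) (λ _ → refl)
    restricted : Fin n → ℤ
    restricted u = surplus s u Σℤ.when R u
    restricted≥0 : ∀ u → + 0 ℤ.≤ restricted u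
    restricted≥0 u with reach? u
    ... | yes path = ¬negative⇒≥0 λ neg → none (u , neg , path)
    ... | no _ = ℤₚ.≤-refl
    restricted-v : restricted v ≡ surplus s v
    restricted-v = Σℤ.when-yes (reach? v) (0 , [])
    3Σ≤0 : + 3 ℤ.* Σℤ.sum restricted ℤ.≤ + 3 ℤ.* + 0
    3Σ≤0 = begin
      + 3 ℤ.* Σℤ.sum restricted
        ≡⟨ sym (sumℤ-*ˡ (+ 3) restricted) ⟩
      Σℤ.sum (λ u → + 3 ℤ.* restricted u)
        ≡⟨ Σℤ.sum-cong-≗ (λ u → sym (sum-when-row u)) ⟩
      Σℤ.sum (λ u → Σℤ.sum (λ w → value s u w Σℤ.when R u))
        ≡⟨ Σℤ.sum-cong-≗ (λ u → trans (Σℤ.sum-cong-≗ (split u)) (Σℤ.∑-distrib-+ (inner u) (outer u))) ⟩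
      Σℤ.sum (λ u → Σℤ.sum (inner u) ℤ.+ Σℤ.sum (outer u))
        ≡⟨ Σℤ.∑-distrib-+ (λ u → Σℤ.sum (inner u)) (λ u → Σℤ.sum (outer u)) ⟩
      Σℤ.sum (λ u → Σℤ.sum (inner u)) ℤ.+ Σℤ.sum (λ u → Σℤ.sum (outer u))
        ≡⟨ cong (ℤ._+ Σℤ.sum (λ u → Σℤ.sum (outer u))) (sum-antisymmetric inner inner-antisym) ⟩
      + 0 ℤ.+ Σℤ.sum (λ u → Σℤ.sum (outer u))
        ≡⟨ ℤₚ.+-identityˡ _ ⟩
      Σℤ.sum (λ u → Σℤ.sum (outer u))
        ≤⟨ sumℤ-mono _ _ (λ u → sumℤ-mono (outer u) (λ _ → + 0) (outer≤0 u)) ⟩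
      Σℤ.sum (λ (_ : Fin n) → Σℤ.sum (λ (_ : Fin n) → + 0))
        ≡⟨ Σℤ.sum-zero (λ (_ : Fin n) → Σℤ.sum (λ (_ : Fin n) → + 0)) (λ _ → Σℤ.sum-zero (λ (_ : Fin n) → + 0) (λ _ → refl)) ⟩
      + 0 ∎
      where open ℤₚ.≤-Reasoning
    surplus≤0 : surplus s v ℤ.≤ + 0
    surplus≤0 = ℤₚ.≤-trans (subst (ℤ._≤ Σℤ.sum restricted) restricted-v (term≤sumℤ restricted restricted≥0 v))
                           (ℤₚ.*-cancelˡ-≤-pos (Σℤ.sum restricted) (+ 0) (+ 3) 3Σ≤0)

  sum-surplus : ∀ s → Σℤ.sum (surplus s) ≡ + 0
  sum-surplus s = ℤₚ.*-cancelˡ-≡ (+ 3) _ _ (trans (sym (sumℤ-*ˡ (+ 3) (surplus s)))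
    (trans (Σℤ.sum-cong-≗ (λ u → sym (row-sum s u))) (sum-antisymmetric (value s) (antisym s))))

  Balanced : State → Set
  Balanced s = ∀ u → Σℤ.sum (value s u) ≡ + 0

  -- By antisymmetry the surpluses sum to 0; if none is positive, all vanish.
  no-surplus⇒balanced : ∀ s → (∀ u → ¬ Positive (surplus s u)) → Balanced s
  no-surplus⇒balanced s none u = trans (row-sum s u) (cong (+ 3 ℤ.*_) (ℤₚ.≤-antisym (≤0 u)
    (ℤₚ.neg-cancel-≤ (subst (ℤ.- surplus s u ℤ.≤_) (trans (sumℤ-neg (surplus s)) (cong ℤ.-_ (sum-surplus s)))
      (term≤sumℤ (ℤ.-_ ∘ surplus s) (λ w → ℤₚ.neg-mono-≤ (≤0 w)) u)))))
    where
    ≤0 : ∀ w → surplus s w ℤ.≤ + 0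
    ≤0 w = ¬positive⇒≤0 (none w)

  balance : ∀ s → Acc _<_ (total s) → ¬ ¬ ∃ Balanced
  balance s (acc smaller) with Finₚ.any? (λ v → positive? (surplus s v))
  ... | no none = pure (s , no-surplus⇒balanced s (λ u p → none (u , p)))
  ... | yes (v , t>0) = ¬¬-all (λ w → ¬¬-excluded-middle {A = ∃[ k ] Path s v w k}) >>= λ reach? →
    let w , t<0 , k , path = deficit-reachable s t>0 reach?
        s′ , lt = augment s (<-wellFounded k) path t>0 t<0
    in balance s′ (smaller lt)

  integral-flow : (∀ u → Σ₃.sum (flow u) ≡ 𝟎) → ¬ ¬ ∃ Balanced
  integral-flow balanced = balance start (<-wellFounded _)
    where
    start : State
    start = record
      { value = λ u v → toℤ (flow u v)
      ; antisym = λ u v → trans (cong toℤ (flow-antisym u v)) (toℤ-⊖ (flow u v))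
      ; represents = λ u v → represents-toℤ (flow u v)
      ; surplus = λ u → proj₁ (sum-toℤ (flow u))
      ; row-sum = λ u → trans (proj₂ (sum-toℤ (flow u)))
          (trans (cong (λ t → + 3 ℤ.* proj₁ (sum-toℤ (flow u)) ℤ.+ toℤ t) (balanced u)) (ℤₚ.+-identityʳ _)) }

-- From pairs of vertices to edges

Small : ℤ → Set
Small x = (0 < ∣ x ∣) × (∣ x ∣ < 3)

-- The totals, of absolute value at most 2, that k values from {±1, ±2} can have.
Fits : ℕ → ℤ → Set
Fits 0 g = g ≡ + 0
Fits 1 g = Small g
Fits (suc (suc _)) g = ∣ g ∣ < 3

Fits-neg : ∀ k {g} → Fits k g → Fits k (ℤ.- g)
Fits-neg 0 refl = refl
Fits-neg 1 {g} (p , q) = subst (0 <_) (sym (ℤₚ.∣-i∣≡∣i∣ g)) p , subst (_< 3) (sym (ℤₚ.∣-i∣≡∣i∣ g)) q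
Fits-neg (suc (suc _)) {g} p = subst (_< 3) (sym (ℤₚ.∣-i∣≡∣i∣ g)) p

represents⇒fits : ∀ k {t x} → Attainable k t → Represents t x → Fits k x
represents⇒fits 0 refl zero = refl
represents⇒fits 1 t≢0 zero = contradiction refl t≢0
represents⇒fits 1 _ one = s≤s z≤n , s≤s (s≤s z≤n)
represents⇒fits 1 _ one′ = s≤s z≤n , s≤s (s≤s (s≤s z≤n))
represents⇒fits 1 _ two = s≤s z≤n , s≤s (s≤s (s≤s z≤n))
represents⇒fits 1 _ two′ = s≤s z≤n , s≤s (s≤s z≤n)
represents⇒fits (suc (suc _)) _ zero = s≤s z≤n
represents⇒fits (suc (suc _)) _ one = s≤s (s≤s z≤n)
represents⇒fits (suc (suc _)) _ one′ = s≤s (s≤s (s≤s z≤n))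
represents⇒fits (suc (suc _)) _ two = s≤s (s≤s (s≤s z≤n))
represents⇒fits (suc (suc _)) _ two′ = s≤s (s≤s z≤n)

-- If edges remain, `x` is chosen so that the remainder is again ±1 or ±2, which suits any positive
-- number of them; the last edge takes all that is left.
detach : ∀ k g → Fits (suc k) g → ∃[ x ] (Small x × Fits k (g ℤ.- x))
detach 0 g fits = g , fits , ℤₚ.+-inverseʳ g
detach (suc k) g fits = let x , small , small′ = choose g fits in x , small , weaken k small′
  where
  weaken : ∀ k {y} → Small y → Fits (suc k) y
  weaken 0 p = p
  weaken (suc _) p = proj₂ p
  choose : ∀ g → ∣ g ∣ < 3 → ∃[ x ] (Small x × Small (g ℤ.- x))
  choose (+ 0) _ = + 1 , (s≤s z≤n , s≤s (s≤s z≤n)) , (s≤s z≤n , s≤s (s≤s z≤n))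
  choose (+ 1) _ = + 2 , (s≤s z≤n , s≤s (s≤s (s≤s z≤n))) , (s≤s z≤n , s≤s (s≤s z≤n))
  choose (+ 2) _ = + 1 , (s≤s z≤n , s≤s (s≤s z≤n)) , (s≤s z≤n , s≤s (s≤s z≤n))
  choose (+ suc (suc (suc _))) (s≤s (s≤s (s≤s ())))
  choose -[1+ 0 ] _ = -[1+ 1 ] , (s≤s z≤n , s≤s (s≤s (s≤s z≤n))) , (s≤s z≤n , s≤s (s≤s z≤n))
  choose -[1+ 1 ] _ = -[1+ 0 ] , (s≤s z≤n , s≤s (s≤s z≤n)) , (s≤s z≤n , s≤s (s≤s z≤n))
  choose -[1+ suc (suc _) ] (s≤s (s≤s (s≤s ())))

Joins : ∀ {n} → Fin n × Fin n → Fin n → Fin n → Set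
Joins (a , b) u v = (a ≡ u × b ≡ v) ⊎ (a ≡ v × b ≡ u)

joins? : ∀ {n} (p : Fin n × Fin n) u v → Dec (Joins p u v)
joins? (a , b) u v = ((a ≟ u) ×-dec (b ≟ v)) ⊎-dec ((a ≟ v) ×-dec (b ≟ u))

joins-sym : ∀ {n} {p : Fin n × Fin n} {u v} → Joins p u v → Joins p v u
joins-sym (inj₁ j) = inj₂ j
joins-sym (inj₂ j) = inj₁ j

multiplicity : ∀ {n m} → (Fin m → Fin n × Fin n) → Fin n → Fin n → ℕ
multiplicity E u v = Σℕ.sum (λ e → 1 Σℕ.when ⌊ joins? (E e) u v ⌋)

when-cong : ∀ {P Q : Set} (d : Dec P) (d′ : Dec Q) → (P → Q) → (Q → P) → 1 Σℕ.when ⌊ d ⌋ ≡ 1 Σℕ.when ⌊ d′ ⌋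
when-cong (yes p) d′ f _ = sym (Σℕ.when-yes d′ (f p))
when-cong (no ¬p) d′ _ g = sym (Σℕ.when-no d′ (¬p ∘ g))

multiplicity-sym : ∀ {n m} (E : Fin m → Fin n × Fin n) u v → multiplicity E u v ≡ multiplicity E v u
multiplicity-sym E u v = Σℕ.sum-cong-≗ λ e → when-cong (joins? (E e) u v) (joins? (E e) v u) joins-sym joins-sym

-- Induction on the edges: `detach` gives the first edge its value, and transferring this amount
-- away leaves totals that the other edges can share.
distribute : ∀ {n} m (E : Fin m → Fin n × Fin n) → (∀ e → proj₁ (E e) ≢ proj₂ (E e)) →
  (g : Fin n → Fin n → ℤ) → (∀ u v → g v u ≡ ℤ.- g u v) → (∀ u v → Fits (multiplicity E u v) (g u v)) →
  Σ[ φ ∈ (Fin m → ℤ) ] ((∀ e → Small (φ e)) ×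
          (∀ v → Σℤ.sum (λ e → φ e Σℤ.when ⌊ proj₁ (E e) ≟ v ⌋) ≡
                 Σℤ.sum (g v) ℤ.+ Σℤ.sum (λ e → φ e Σℤ.when ⌊ proj₂ (E e) ≟ v ⌋)))
distribute zero E loopless g anti fits = (λ ()) , (λ ()) , λ v →
  sym (trans (ℤₚ.+-identityʳ (Σℤ.sum (g v))) (Σℤ.sum-zero (g v) (fits v)))
distribute {n} (suc m) E loopless g anti fits =
  let φ , small , conserved = distribute m (E ∘ suc) (loopless ∘ suc) g′ g′-antisym fits′
  in extend φ , (λ { zero → x-small ; (suc e) → small e }) , λ v →
     append (x Σℤ.when ⌊ a ≟ v ⌋) (x Σℤ.when ⌊ b ≟ v ⌋) (Σℤ.sum (g v)) (Σℤ.sum (g′ v)) _ _ (conserved v) (g′-sum v)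
  where
  a b : Fin n
  a = proj₁ (E zero)
  b = proj₂ (E zero)
  a≢b : a ≢ b
  a≢b = loopless zero
  E′ : Fin m → Fin n × Fin n
  E′ = E ∘ suc
  joined : ∀ {u v} → Joins (E zero) u v → Fits (suc (multiplicity E′ u v)) (g u v)
  joined {u} {v} j = subst (λ k → Fits (k ℕ.+ multiplicity E′ u v) (g u v)) (Σℕ.when-yes (joins? (E zero) u v) j) (fits u v)
  chosen : ∃[ x ] (Small x × Fits (multiplicity E′ a b) (g a b ℤ.- x))
  chosen = detach (multiplicity E′ a b) (g a b) (joined (inj₁ (refl , refl)))
  x : ℤ
  x = proj₁ chosen
  x-small : Small x
  x-small = proj₁ (proj₂ chosen)
  open Transfer g anti a b a≢b x
  fits′ : ∀ u v → Fits (multiplicity E′ u v) (g′ u v)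
  fits′ = g′-cases (λ u v y → Fits (multiplicity E′ u v) y) (proj₂ (proj₂ chosen))
    (subst₂ Fits (multiplicity-sym E′ a b) (trans (negate (g a b) x) (cong (ℤ._+ x) (sym (anti a b))))
      (Fits-neg (multiplicity E′ a b) (proj₂ (proj₂ chosen))))
    (λ u v ¬ab ¬ba → subst (λ k → Fits (k ℕ.+ multiplicity E′ u v) (g u v))
      (Σℕ.when-no (joins? (E zero) u v) λ { (inj₁ (p , q)) → ¬ab (sym p , sym q) ; (inj₂ (p , q)) → ¬ba (sym q , sym p) })
      (fits u v))
    where
    negate : ∀ y x → ℤ.- (y ℤ.- x) ≡ ℤ.- y ℤ.+ x
    negate = solve-∀
  extend : (Fin m → ℤ) → Fin (suc m) → ℤ
  extend φ zero = x
  extend φ (suc e) = φ e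
  append : ∀ xa xb s s′ o i → o ≡ s′ ℤ.+ i → s′ ℤ.+ xa ≡ s ℤ.+ xb → xa ℤ.+ o ≡ s ℤ.+ (xb ℤ.+ i)
  append xa xb s s′ o i refl eq = trans (ring₁ xa s′ i) (trans (cong (ℤ._+ i) eq) (ℤₚ.+-assoc s xb i))
    where
    ring₁ : ∀ xa s′ i → xa ℤ.+ (s′ ℤ.+ i) ≡ s′ ℤ.+ xa ℤ.+ i
    ring₁ = solve-∀

sumℤ≡sum : ∀ k (f : Fin k → ℤ) → sumℤ k f ≡ Σℤ.sum f
sumℤ≡sum zero f = refl
sumℤ≡sum (suc k) f = cong (λ s → f zero ℤ.+ s) (sumℤ≡sum k (f ∘ suc))

sumℕ≡sum : ∀ k (f : Fin k → ℕ) → sumℕ k f ≡ Σℕ.sum f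
sumℕ≡sum zero f = refl
sumℕ≡sum (suc k) f = cong (f zero ℕ.+_) (sumℕ≡sum k (f ∘ suc))

sumℤ-cong : ∀ k {f g : Fin k → ℤ} → (∀ i → f i ≡ g i) → sumℤ k f ≡ sumℤ k g
sumℤ-cong k {f} {g} eq = trans (sumℤ≡sum k f) (trans (Σℤ.sum-cong-≗ eq) (sym (sumℤ≡sum k g)))

sumℕ-mono : ∀ {k} (f g : Fin k → ℕ) → (∀ i → f i ≤ g i) → Σℕ.sum f ≤ Σℕ.sum g
sumℕ-mono {zero} f g f≤g = z≤n
sumℕ-mono {suc k} f g f≤g = ℕₚ.+-mono-≤ (f≤g zero) (sumℕ-mono (f ∘ suc) (g ∘ suc) (f≤g ∘ suc))

-- From a graph to its multiplicities and back

module _ (G : Graph) (loopless : Loopless G) where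
  open AutOps G

  μ : Vtx G → Vtx G → ℕ
  μ = multiplicity (ends G)

  μ-irrefl : ∀ u → μ u u ≡ 0
  μ-irrefl u = Σℕ.sum-zero _ λ e → Σℕ.when-no (joins? (ends G e) u u)
    λ { (inj₁ (p , q)) → loopless e (trans p (sym q)) ; (inj₂ (p , q)) → loopless e (trans p (sym q)) }

  degree≡sum : ∀ v → degree G v ≡ Σℕ.sum (μ v)
  degree≡sum v = begin
    degree G v
      ≡⟨ sumℕ≡sum (m G) _ ⟩
    Σℕ.sum (λ e → ind (proj₁ (ends G e)) v ℕ.+ ind (proj₂ (ends G e)) v)
      ≡⟨ Σℕ.sum-cong-≗ (λ e → sym (edge-degree (proj₁ (ends G e)) (proj₂ (ends G e)) (loopless e))) ⟩
    Σℕ.sum (λ e → Σℕ.sum (λ u → 1 Σℕ.when ⌊ joins? (ends G e) v u ⌋))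
      ≡⟨ Σℕ.∑-comm (λ e u → 1 Σℕ.when ⌊ joins? (ends G e) v u ⌋) ⟩
    Σℕ.sum (μ v) ∎
    where
    open ≡-Reasoning
    edge-degree : ∀ a b → a ≢ b → Σℕ.sum (λ u → 1 Σℕ.when ⌊ joins? (a , b) v u ⌋) ≡ ind a v ℕ.+ ind b v
    edge-degree a b a≢b = by-cases (a ≟ v) (b ≟ v)
      where
      by-cases : (d : Dec (a ≡ v)) (d′ : Dec (b ≡ v)) →
        Σℕ.sum (λ u → 1 Σℕ.when ⌊ joins? (a , b) v u ⌋) ≡ 1 Σℕ.when ⌊ d ⌋ ℕ.+ 1 Σℕ.when ⌊ d′ ⌋
      by-cases (yes a≡v) (yes b≡v) = contradiction (trans a≡v (sym b≡v)) a≢b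
      by-cases (yes a≡v) (no b≢v) = trans (Σℕ.sum-cong-≗ λ u → when-cong (joins? (a , b) v u) (b ≟ u)
        (λ { (inj₁ (_ , e)) → e ; (inj₂ (_ , e)) → contradiction e b≢v }) (λ e → inj₁ (a≡v , e)))
        (Σℕ.sum-when′ (λ _ → 1) b)
      by-cases (no a≢v) (yes b≡v) = trans (Σℕ.sum-cong-≗ λ u → when-cong (joins? (a , b) v u) (a ≟ u)
        (λ { (inj₁ (e , _)) → contradiction e a≢v ; (inj₂ (e , _)) → e }) (λ e → inj₂ (e , b≡v)))
        (Σℕ.sum-when′ (λ _ → 1) a)
      by-cases (no a≢v) (no b≢v) = Σℕ.sum-zero _ λ u → Σℕ.when-no (joins? (a , b) v u)
        λ { (inj₁ (e , _)) → a≢v e ; (inj₂ (_ , e)) → b≢v e }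

  -- Without loops the ends of an edge are two distinct vertices incident with it, so preserving
  -- incidence suffices to preserve the pair of ends.
  aut-joins : ∀ σ τ → IsAut G (σ , τ) → ∀ e {u v} → Joins (ends G e) u v → Joins (ends G (τ ⟨$⟩ʳ e)) (σ ⟨$⟩ʳ u) (σ ⟨$⟩ʳ v)
  aut-joins σ τ aut e j = case j of λ
    { (inj₁ (p , q)) → from-inc (incident (inj₁ (sym p))) (incident (inj₂ (sym q)))
        (λ eq → loopless e (trans p (trans (σ-injective eq) (sym q))))
    ; (inj₂ (p , q)) → from-inc (incident (inj₂ (sym q))) (incident (inj₁ (sym p)))
        (λ eq → loopless e (trans p (trans (sym (σ-injective eq)) (sym q)))) }
    where
    incident : ∀ {w} → Inc G w e → Inc G (σ ⟨$⟩ʳ w) (τ ⟨$⟩ʳ e)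
    incident {w} = Equivalence.to (aut w e)
    σ-injective : ∀ {u v} → σ ⟨$⟩ʳ u ≡ σ ⟨$⟩ʳ v → u ≡ v
    σ-injective eq = trans (sym (Perm.inverseˡ σ)) (trans (cong (σ Perm.⟨$⟩ˡ_) eq) (Perm.inverseˡ σ))
    from-inc : ∀ {e u v} → Inc G u e → Inc G v e → u ≢ v → Joins (ends G e) u v
    from-inc (inj₁ p) (inj₁ q) u≢v = contradiction (trans p (sym q)) u≢v
    from-inc (inj₁ p) (inj₂ q) _ = inj₁ (sym p , sym q)
    from-inc (inj₂ p) (inj₁ q) _ = inj₂ (sym q , sym p)
    from-inc (inj₂ p) (inj₂ q) u≢v = contradiction (trans p (sym q)) u≢v

  -- `τ` permutes the summands, and each is bounded by its image. The opposite inequality will come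
  -- from the inverse element.
  μ-aut : ∀ σ τ → IsAut G (σ , τ) → ∀ u v → μ u v ≤ μ (σ ⟨$⟩ʳ u) (σ ⟨$⟩ʳ v)
  μ-aut σ τ aut u v = subst (μ u v ≤_)
    (sym (Σℕ.sum-permute (λ e → 1 Σℕ.when ⌊ joins? (ends G e) (σ ⟨$⟩ʳ u) (σ ⟨$⟩ʳ v) ⌋) τ))
    (sumℕ-mono _ _ λ e → when-mono (joins? (ends G e) u v) (joins? (ends G (τ ⟨$⟩ʳ e)) (σ ⟨$⟩ʳ u) (σ ⟨$⟩ʳ v)) (aut-joins σ τ aut e))
    where
    when-mono : ∀ {P Q : Set} (d : Dec P) (d′ : Dec Q) → (P → Q) → 1 Σℕ.when ⌊ d ⌋ ≤ 1 Σℕ.when ⌊ d′ ⌋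
    when-mono (yes p) d′ f = ℕₚ.≤-reflexive (sym (Σℕ.when-yes d′ (f p)))
    when-mono (no _) d′ _ = z≤n

  module _ (H : Perm G → Set) (sub : IsSubgroupOfAut H) (nil : IsNilpotent H) (trn : ActsTransitively H)
           (deg : ∀ v → 4 ≤ degree G v) where
    open IsSubgroupOfAut sub

    X : Set
    X = ∃ H

    _·′_ : X → X → X
    (x , hx) ·′ (y , hy) = x · y , ·-closed x y hx hy

    _⁻¹′ : X → X
    (x , hx) ⁻¹′ = x ⁻¹ , ⁻¹-closed x hx

    open NilpotentAction _·′_ _⁻¹′ using (Action; module ActionProperties)
    open NilpotentGraph _·′_ _⁻¹′ (proj₁ nil)

    vertex-action : Action (n G)
    vertex-action = record
      { act = λ x → proj₁ (proj₁ x) ⟨$⟩ʳ_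
      ; act-· = λ _ _ _ → refl
      ; act-⁻¹ˡ = λ x v → Perm.inverseˡ (proj₁ (proj₁ x))
      ; act-⁻¹ʳ = λ x v → Perm.inverseʳ (proj₁ (proj₁ x))
      ; transitive = λ u v → let x , hx , eq = trn u v in (x , hx) , eq }

    Z⇒Z : ∀ i x → Z H i (proj₁ x) → ActionProperties.Z vertex-action i x
    Z⇒Z zero x (triv , _) = triv
    Z⇒Z (suc i) x (_ , below) y = Z⇒Z i _ (below (proj₁ y) (proj₂ y))

    open Action vertex-action

    μ-invariant : ∀ x u v → μ (act x u) (act x v) ≡ μ u v
    μ-invariant x u v = ℕₚ.≤-antisym
      (subst₂ (λ u′ v′ → μ (act x u) (act x v) ≤ μ u′ v′) (act-⁻¹ˡ x u) (act-⁻¹ˡ x v) (grow (x ⁻¹′) (act x u) (act x v)))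
      (grow x u v)
      where
      grow : ∀ x u v → μ u v ≤ μ (act x u) (act x v)
      grow ((σ , τ) , hx) = μ-aut σ τ (⊆aut (σ , τ) hx)

    weighted : Weighted (n G)
    weighted = record
      { action = vertex-action
      ; nilpotent = λ x → Z⇒Z (proj₁ nil) x (proj₂ nil (proj₁ x) (proj₂ x))
      ; μ = μ
      ; μ-sym = multiplicity-sym (ends G)
      ; μ-irrefl = μ-irrefl
      ; invariant = μ-invariant
      ; degree≥4 = λ v → subst (4 ≤_) (degree≡sum v) (deg v) }

    -- All edges keep the orientation given by `ends`; directions are expressed by the signs of `φ`.
    Conserved : (Edg G → ℤ) → Set
    Conserved φ = ∀ v → φ⁺ G (λ _ → true) φ v ≡ φ⁻ G (λ _ → true) φ v

    ¬¬-flow : ¬ ¬ (Σ[ φ ∈ (Edg G → ℤ) ] ((∀ e → Small (φ e)) × Conserved φ))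
    ¬¬-flow = flow-mod-3 weighted >>= λ F → let open Flow₃ F in
      Tutte.integral-flow flow antisym balanced >>= λ (s , s-balanced) →
      let open Tutte.State s renaming (antisym to value-antisym)
          φ , small , conserved = distribute (m G) (ends G) loopless value value-antisym
            (λ u v → represents⇒fits (μ u v) (attainable u v) (represents u v))
      in pure (φ , small , λ v → trans (sumℤ≡sum (m G) _) (trans (conserved v)
           (trans (cong (λ y → y ℤ.+ Σℤ.sum (λ e → φ e Σℤ.when ⌊ proj₂ (ends G e) ≟ v ⌋)) (s-balanced v))
             (trans (ℤₚ.+-identityˡ _) (sym (sumℤ≡sum (m G) _))))))

    decode : Fin 4 → ℤ
    decode 0F = -[1+ 1 ]
    decode 1F = -[1+ 0 ]
    decode 2F = + 1
    decode 3F = + 2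

    decode-small : ∀ i → Small (decode i)
    decode-small 0F = s≤s z≤n , s≤s (s≤s (s≤s z≤n))
    decode-small 1F = s≤s z≤n , s≤s (s≤s z≤n)
    decode-small 2F = s≤s z≤n , s≤s (s≤s z≤n)
    decode-small 3F = s≤s z≤n , s≤s (s≤s (s≤s z≤n))

    encode : ∀ x → Small x → ∃[ i ] decode i ≡ x
    encode (+ 1) _ = 2F , refl
    encode (+ 2) _ = 3F , refl
    encode (+ suc (suc (suc _))) (_ , s≤s (s≤s (s≤s ())))
    encode -[1+ 0 ] _ = 1F , refl
    encode -[1+ 1 ] _ = 0F , refl
    encode -[1+ suc (suc _) ] (_ , s≤s (s≤s (s≤s ())))

    Conserved-cong : ∀ {φ ψ} → (∀ e → φ e ≡ ψ e) → Conserved φ → Conserved ψ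
    Conserved-cong {φ} {ψ} eq conserved v = trans (sym (side (proj₁ ∘ ends G))) (trans (conserved v) (side (proj₂ ∘ ends G)))
      where
      side : ∀ (end : Edg G → Vtx G) → sumℤ (m G) (λ e → if ⌊ end e ≟ v ⌋ then φ e else + 0) ≡ sumℤ (m G) (λ e → if ⌊ end e ≟ v ⌋ then ψ e else + 0)
      side end = sumℤ-cong (m G) λ e → cong (λ y → if ⌊ end e ≟ v ⌋ then y else + 0) (eq e)

    nowhere-zero-3-flow : AdmitsNZFlow G 3
    nowhere-zero-3-flow =
      -- The assignments of ±1 and ±2 to the edges are numbered by `Fin (4 ^ m G)` and conservation
      -- is decidable for each, so the existence of a flow is decidable and the double negation can
      -- be removed.
      let k , conserved = decidable-stable (Finₚ.any? {n = 4 ^ m G} conserved?) (¬¬-flow >>= pure ∘ candidate)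
      in (λ _ → true) , decode ∘ finToFun k , (λ e → decode-small (finToFun k e)) , conserved
      where
      conserved? : ∀ k → Dec (Conserved (decode ∘ finToFun {4} {m G} k))
      conserved? k = Finₚ.all? λ v → _ ℤ.≟ _
      candidate : Σ[ φ ∈ (Edg G → ℤ) ] ((∀ e → Small (φ e)) × Conserved φ) → ∃[ k ] Conserved (decode ∘ finToFun {4} {m G} k)
      candidate (φ , small , conserved) = funToFin code , Conserved-cong
        (λ e → trans (sym (proj₂ (encode (φ e) (small e)))) (cong decode (sym (Finₚ.finToFun-funToFin code e)))) conserved
        where
        code : Edg G → Fin 4
        code e = proj₁ (encode (φ e) (small e))

theorem1p1 : (G : Graph) → Loopless G → NilpotentlyVertexTransitive G →
    ((v : Vtx G) → 4 ≤ degree G v) → AdmitsNZFlow G 3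
theorem1p1 G loopless (H , sub , nil , trn) deg = nowhere-zero-3-flow G loopless H sub nil trn deg
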